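{- Let $0<s<m$, let $t$ be a legitimate quadruple, and let $l\in L^*\setminus(L^*)^{\sigma-1}$ (so $l\neq0$). Let $S$ be a semifield isotopic to $B(2,m,s,l,t)$. Then the center, the left nucleus and the right nucleus of $S$ coincide, and they are isomorphic to $K_1=\mathbb{F}_{2^{\gcd(m,s)}}$.
   Context: A (finite) presemifield is a finite additive abelian group with a multiplication that is distributive on both sides over addition and has no zero divisors; it is a semifield if it also has a multiplicative identity. Two presemifields $(F,+,*)$ and $(F,+,\circ)$ are isotopic if there are additive bijections $\alpha_1,\alpha_2,\beta$ with $\beta(\alpha_1(x)*\alpha_2(y))=x\circ y$ for all $x,y$. In a semifield, an element $u$ belongs to the left, middle, right nucleus if, respectively, $u*(y*w)=(u*y)*w$, $y*(u*w)=(y*u)*w$, $y*(w*u)=(y*w)*u$ for all $y,w$; the center consists of the elements in all three nuclei that commute with every element. Let $m\ge 1$, $L=GF(2^m)$, $\sigma=2^s$, $(L^*)^{\sigma-1}=\{u^{\sigma-1}:u\in L^*\}$. A quadruple $t=[p_1,p_2,p_3,p_4]\in L^4$ is legitimate if $p_1\neq0$ and $p_1X^{\sigma+1}+p_2X^{\sigma}+p_3X+p_4$ has no root in $L$. $B(2,m,s,l,t)$ is the presemifield on $L\times L$ with multiplication $$(a,b)\circ(c,d)=(p_1ac^{\sigma}+lp_1a^{\sigma}c+p_2bc^{\sigma}+lp_2a^{\sigma}d+p_3ad^{\sigma}+lp_3b^{\sigma}c+p_4bd^{\sigma}+lp_4b^{\sigma}d,\ ad+bc).$$ -}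

module Defs where

open import Algebra.Bundles using (CommutativeRing; Group; RawRing; RawRingWithoutOne)
open import Algebra.Core using (Op₁; Op₂)
open import Algebra.Definitions using (Identity; _DistributesOver_)
open import Algebra.Morphism.Structures using (module GroupMorphisms; module RingMorphisms)
import Algebra.Properties.Group as GroupProperties
import Algebra.Properties.Semiring.Exp as Exp
open import Algebra.Structures using (IsAbelianGroup; IsCommutativeRing)
open import Data.Fin.Base using (Fin)
open import Data.Nat.Base as ℕ using (ℕ)
open import Data.Product.Base using (Σ; ∃; _×_; _,_; proj₁; proj₂)
open import Data.Sum.Base using (_⊎_)
open import Function.Base using (_on_)
open import Function.Bundles using (Inverse; _↔_)
open import Level using (Level; _⊔_; suc)
open import Relation.Binary.Bundles using (Setoid)
import Relation.Binary.Construct.On as On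
open import Relation.Binary.PropositionalEquality.Core
  using (_≡_; _≢_; refl; sym; trans; cong; cong₂)
import Relation.Binary.PropositionalEquality.Properties as ≡
open import Relation.Nullary.Negation.Core using (¬_)
open import Relation.Unary using (Pred)

private
  variable
    a b c ℓ ℓ₁ ℓ₂ p : Level

infix 4 _≅_

_≅_ : RawRing a ℓ₁ → RawRing b ℓ₂ → Set (a ⊔ b ⊔ ℓ₁ ⊔ ℓ₂)
R ≅ T = ∃ (RingMorphisms.IsRingIsomorphism R T)

HasOrder : Setoid c ℓ → ℕ → Set (c ⊔ ℓ)
HasOrder A n = Inverse A (≡.setoid (Fin n))

record IsSubring (R : RawRing c ℓ) (P : Pred (RawRing.Carrier R) p) : Set (c ⊔ p) where
  open RawRing R
  field
    +-closed  : ∀ {x y} → P x → P y → P (x + y)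
    *-closed  : ∀ {x y} → P x → P y → P (x * y)
    -‿closed  : ∀ {x} → P x → P (- x)
    0#-closed : P 0#
    1#-closed : P 1#

  -- Elements of the subset are compared in R: the membership proofs,
  -- which need not be unique, are ignored.
  rawRing : RawRing (c ⊔ p) ℓ
  rawRing = record
    { Carrier = Σ Carrier P
    ; _≈_     = _≈_ on proj₁
    ; _+_     = λ (x , Px) (y , Py) → x + y , +-closed Px Py
    ; _*_     = λ (x , Px) (y , Py) → x * y , *-closed Px Py
    ; -_      = λ (x , Px) → - x , -‿closed Px
    ; 0#      = 0# , 0#-closed
    ; 1#      = 1# , 1#-closed
    }

record GF (q : ℕ) (c : Level) : Set (suc c) where
  infix  8 -_
  infixl 7 _*_
  infixl 6 _+_
  field
    Carrier           : Set c
    _+_ _*_           : Op₂ Carrier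
    -_                : Op₁ Carrier
    0# 1#             : Carrier
    isCommutativeRing : IsCommutativeRing _≡_ _+_ _*_ -_ 0# 1#
    0≢1               : 0# ≢ 1#
    inverse           : ∀ x → x ≢ 0# → ∃ λ y → x * y ≡ 1#
    order             : HasOrder (≡.setoid Carrier) q

  commutativeRing : CommutativeRing c c
  commutativeRing = record { isCommutativeRing = isCommutativeRing }

  open CommutativeRing commutativeRing public using (rawRing; semiring)
  open Exp semiring public using (_^_)

record Subfield {q} (L : GF q c) : Set (suc c) where
  open GF L using (Carrier; _*_; 0#; 1#)
  field
    Member    : Pred Carrier c
    isSubring : IsSubring (GF.rawRing L) Member
    inverse   : ∀ {x} → Member x → x ≢ 0# → ∃ λ y → Member y × x * y ≡ 1#

  open IsSubring isSubring public using (rawRing)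

  setoid : Setoid c c
  setoid = On.setoid {B = Σ Carrier Member} (≡.setoid Carrier) proj₁

record IsPresemifield {A : Set c} (_+_ _*_ : Op₂ A) (-_ : Op₁ A) (0# : A) : Set c where
  field
    +-isAbelianGroup : IsAbelianGroup _≡_ _+_ 0# -_
    distrib          : _DistributesOver_ _≡_ _*_ _+_
    noZeroDivisors   : ∀ {x y} → x * y ≡ 0# → x ≡ 0# ⊎ y ≡ 0#
    finite           : ∃ λ n → A ↔ Fin n

record Semifield (c : Level) : Set (suc c) where
  infix  8 -_
  infixl 7 _*_
  infixl 6 _+_
  field
    Carrier        : Set c
    _+_ _*_        : Op₂ Carrier
    -_             : Op₁ Carrier
    0# 1#          : Carrier
    isPresemifield : IsPresemifield _+_ _*_ -_ 0#
    *-identity     : Identity _≡_ 1# _*_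

  open IsPresemifield isPresemifield public

  rawRing : RawRing c c
  rawRing = record
    { _≈_ = _≡_ ; _+_ = _+_ ; _*_ = _*_ ; -_ = -_ ; 0# = 0# ; 1# = 1# }

  open RawRing rawRing public using (rawRingWithoutOne)

-- Only the operations of the two presemifields enter the definition, so it
-- applies to B below without first showing that B is a presemifield.
record Isotopic (P : RawRingWithoutOne a ℓ₁) (Q : RawRingWithoutOne b ℓ₂)
                : Set (a ⊔ b ⊔ ℓ₁ ⊔ ℓ₂) where
  private
    module P = RawRingWithoutOne P
    module Q = RawRingWithoutOne Q
    module Q→P = GroupMorphisms Q.+-rawGroup P.+-rawGroup
    module P→Q = GroupMorphisms P.+-rawGroup Q.+-rawGroup
  field
    α₁ α₂       : Q.Carrier → P.Carrier
    β           : P.Carrier → Q.Carrier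
    α₁-additive : Q→P.IsGroupIsomorphism α₁
    α₂-additive : Q→P.IsGroupIsomorphism α₂
    β-additive  : P→Q.IsGroupIsomorphism β
    isotopy     : ∀ x y → β (α₁ x P.* α₂ y) Q.≈ x Q.* y

module _ (S : Semifield c) where
  open Semifield S

  LeftNucleus MiddleNucleus RightNucleus Center : Pred Carrier c
  LeftNucleus   u = ∀ y w → u * (y * w) ≡ (u * y) * w
  MiddleNucleus u = ∀ y w → y * (u * w) ≡ (y * u) * w
  RightNucleus  u = ∀ y w → y * (w * u) ≡ (y * w) * u
  Center u = LeftNucleus u × MiddleNucleus u × RightNucleus u × (∀ y → u * y ≡ y * u)

  private
    open IsAbelianGroup +-isAbelianGroup
      using (isGroup; identityˡ; inverseˡ)

    +-group : Group c c
    +-group = record { isGroup = isGroup }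

    open GroupProperties +-group using (identityˡ-unique; inverseˡ-unique)
    open ≡.≡-Reasoning

    distribˡ : ∀ x y z → x * (y + z) ≡ x * y + x * z
    distribˡ = proj₁ distrib

    distribʳ : ∀ x y z → (y + z) * x ≡ y * x + z * x
    distribʳ = proj₂ distrib

    idˡ : ∀ x → 1# * x ≡ x
    idˡ = proj₁ *-identity

    idʳ : ∀ x → x * 1# ≡ x
    idʳ = proj₂ *-identity

    zeroˡ : ∀ x → 0# * x ≡ 0#
    zeroˡ x = identityˡ-unique (0# * x) (0# * x)
      (trans (sym (distribʳ x 0# 0#)) (cong (_* x) (identityˡ 0#)))

    zeroʳ : ∀ x → x * 0# ≡ 0#
    zeroʳ x = identityˡ-unique (x * 0#) (x * 0#)
      (trans (sym (distribˡ x 0# 0#)) (cong (x *_) (identityˡ 0#)))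

    -‿*ˡ : ∀ x y → - x * y ≡ - (x * y)
    -‿*ˡ x y = inverseˡ-unique (- x * y) (x * y)
      (trans (sym (distribʳ y (- x) x)) (trans (cong (_* y) (inverseˡ x)) (zeroˡ y)))

    -‿*ʳ : ∀ x y → x * - y ≡ - (x * y)
    -‿*ʳ x y = inverseˡ-unique (x * - y) (x * y)
      (trans (sym (distribˡ x (- y) y)) (trans (cong (x *_) (inverseˡ y)) (zeroʳ x)))

  leftNucleus-isSubring : IsSubring rawRing LeftNucleus
  leftNucleus-isSubring = record
    { +-closed = λ {u} {v} Nu Nv y w → begin
        (u + v) * (y * w)           ≡⟨ distribʳ _ _ _ ⟩
        u * (y * w) + v * (y * w)   ≡⟨ cong₂ _+_ (Nu y w) (Nv y w) ⟩
        (u * y) * w + (v * y) * w   ≡⟨ distribʳ _ _ _ ⟨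
        (u * y + v * y) * w         ≡⟨ cong (_* w) (distribʳ _ _ _) ⟨
        ((u + v) * y) * w           ∎
    ; *-closed = λ {u} {v} Nu Nv y w → begin
        (u * v) * (y * w)           ≡⟨ Nu v (y * w) ⟨
        u * (v * (y * w))           ≡⟨ cong (u *_) (Nv y w) ⟩
        u * ((v * y) * w)           ≡⟨ Nu (v * y) w ⟩
        (u * (v * y)) * w           ≡⟨ cong (_* w) (Nu v y) ⟩
        ((u * v) * y) * w           ∎
    ; -‿closed = λ {u} Nu y w → begin
        - u * (y * w)               ≡⟨ -‿*ˡ _ _ ⟩
        - (u * (y * w))             ≡⟨ cong -_ (Nu y w) ⟩
        - ((u * y) * w)             ≡⟨ -‿*ˡ _ _ ⟨
        - (u * y) * w               ≡⟨ cong (_* w) (-‿*ˡ _ _) ⟨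
        (- u * y) * w               ∎
    ; 0#-closed = λ y w → begin
        0# * (y * w)                ≡⟨ zeroˡ _ ⟩
        0#                          ≡⟨ zeroˡ w ⟨
        0# * w                      ≡⟨ cong (_* w) (zeroˡ y) ⟨
        (0# * y) * w                ∎
    ; 1#-closed = λ y w → trans (idˡ _) (sym (cong (_* w) (idˡ y)))
    }

  middleNucleus-isSubring : IsSubring rawRing MiddleNucleus
  middleNucleus-isSubring = record
    { +-closed = λ {u} {v} Nu Nv y w → begin
        y * ((u + v) * w)           ≡⟨ cong (y *_) (distribʳ _ _ _) ⟩
        y * (u * w + v * w)         ≡⟨ distribˡ _ _ _ ⟩
        y * (u * w) + y * (v * w)   ≡⟨ cong₂ _+_ (Nu y w) (Nv y w) ⟩
        (y * u) * w + (y * v) * w   ≡⟨ distribʳ _ _ _ ⟨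
        (y * u + y * v) * w         ≡⟨ cong (_* w) (distribˡ _ _ _) ⟨
        (y * (u + v)) * w           ∎
    ; *-closed = λ {u} {v} Nu Nv y w → begin
        y * ((u * v) * w)           ≡⟨ cong (y *_) (Nv u w) ⟨
        y * (u * (v * w))           ≡⟨ Nu y (v * w) ⟩
        (y * u) * (v * w)           ≡⟨ Nv (y * u) w ⟩
        ((y * u) * v) * w           ≡⟨ cong (_* w) (Nu y v) ⟨
        (y * (u * v)) * w           ∎
    ; -‿closed = λ {u} Nu y w → begin
        y * (- u * w)               ≡⟨ cong (y *_) (-‿*ˡ _ _) ⟩
        y * - (u * w)               ≡⟨ -‿*ʳ _ _ ⟩
        - (y * (u * w))             ≡⟨ cong -_ (Nu y w) ⟩
        - ((y * u) * w)             ≡⟨ -‿*ˡ _ _ ⟨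
        - (y * u) * w               ≡⟨ cong (_* w) (-‿*ʳ _ _) ⟨
        (y * - u) * w               ∎
    ; 0#-closed = λ y w → begin
        y * (0# * w)                ≡⟨ cong (y *_) (zeroˡ w) ⟩
        y * 0#                      ≡⟨ zeroʳ y ⟩
        0#                          ≡⟨ zeroˡ w ⟨
        0# * w                      ≡⟨ cong (_* w) (zeroʳ y) ⟨
        (y * 0#) * w                ∎
    ; 1#-closed = λ y w → trans (cong (y *_) (idˡ w)) (sym (cong (_* w) (idʳ y)))
    }

  rightNucleus-isSubring : IsSubring rawRing RightNucleus
  rightNucleus-isSubring = record
    { +-closed = λ {u} {v} Nu Nv y w → begin
        y * (w * (u + v))           ≡⟨ cong (y *_) (distribˡ _ _ _) ⟩
        y * (w * u + w * v)         ≡⟨ distribˡ _ _ _ ⟩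
        y * (w * u) + y * (w * v)   ≡⟨ cong₂ _+_ (Nu y w) (Nv y w) ⟩
        (y * w) * u + (y * w) * v   ≡⟨ distribˡ _ _ _ ⟨
        (y * w) * (u + v)           ∎
    ; *-closed = λ {u} {v} Nu Nv y w → begin
        y * (w * (u * v))           ≡⟨ cong (y *_) (Nv w u) ⟩
        y * ((w * u) * v)           ≡⟨ Nv y (w * u) ⟩
        (y * (w * u)) * v           ≡⟨ cong (_* v) (Nu y w) ⟩
        ((y * w) * u) * v           ≡⟨ Nv (y * w) u ⟨
        (y * w) * (u * v)           ∎
    ; -‿closed = λ {u} Nu y w → begin
        y * (w * - u)               ≡⟨ cong (y *_) (-‿*ʳ _ _) ⟩
        y * - (w * u)               ≡⟨ -‿*ʳ _ _ ⟩
        - (y * (w * u))             ≡⟨ cong -_ (Nu y w) ⟩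
        - ((y * w) * u)             ≡⟨ -‿*ʳ _ _ ⟨
        (y * w) * - u               ∎
    ; 0#-closed = λ y w → begin
        y * (w * 0#)                ≡⟨ cong (y *_) (zeroʳ w) ⟩
        y * 0#                      ≡⟨ zeroʳ y ⟩
        0#                          ≡⟨ zeroʳ _ ⟨
        (y * w) * 0#                ∎
    ; 1#-closed = λ y w → trans (cong (y *_) (idʳ w)) (sym (idʳ _))
    }

  center-isSubring : IsSubring rawRing Center
  center-isSubring = record
    { +-closed = λ {u} {v} (lu , mu , ru , cu) (lv , mv , rv , cv) →
        L.+-closed lu lv , M.+-closed mu mv , R.+-closed ru rv , λ y → begin
          (u + v) * y     ≡⟨ distribʳ _ _ _ ⟩
          u * y + v * y   ≡⟨ cong₂ _+_ (cu y) (cv y) ⟩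
          y * u + y * v   ≡⟨ distribˡ _ _ _ ⟨
          y * (u + v)     ∎
    ; *-closed = λ {u} {v} (lu , mu , ru , cu) (lv , mv , rv , cv) →
        L.*-closed lu lv , M.*-closed mu mv , R.*-closed ru rv , λ y → begin
          (u * v) * y     ≡⟨ lu v y ⟨
          u * (v * y)     ≡⟨ cong (u *_) (cv y) ⟩
          u * (y * v)     ≡⟨ lu y v ⟩
          (u * y) * v     ≡⟨ cong (_* v) (cu y) ⟩
          (y * u) * v     ≡⟨ mu y v ⟨
          y * (u * v)     ∎
    ; -‿closed = λ {u} (lu , mu , ru , cu) →
        L.-‿closed lu , M.-‿closed mu , R.-‿closed ru , λ y →
          trans (-‿*ˡ u y) (trans (cong -_ (cu y)) (sym (-‿*ʳ y u)))
    ; 0#-closed = L.0#-closed , M.0#-closed , R.0#-closed , λ y →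
        trans (zeroˡ y) (sym (zeroʳ y))
    ; 1#-closed = L.1#-closed , M.1#-closed , R.1#-closed , λ y →
        trans (idˡ y) (sym (idʳ y))
    }
    where
    module L = IsSubring leftNucleus-isSubring
    module M = IsSubring middleNucleus-isSubring
    module R = IsSubring rightNucleus-isSubring

  leftNucleus middleNucleus rightNucleus center : RawRing c c
  leftNucleus   = IsSubring.rawRing leftNucleus-isSubring
  middleNucleus = IsSubring.rawRing middleNucleus-isSubring
  rightNucleus  = IsSubring.rawRing rightNucleus-isSubring
  center        = IsSubring.rawRing center-isSubring

module _ {q : ℕ} (L : GF q c) (s : ℕ) where
  open GF L

  private
    σ : ℕ
    σ = 2 ℕ.^ s

  Quadruple : Set c
  Quadruple = Carrier × Carrier × Carrier × Carrier

  Legitimate : Quadruple → Set c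
  Legitimate (p₁ , p₂ , p₃ , p₄) =
    p₁ ≢ 0# ×
    ¬ (∃ λ X → p₁ * X ^ (σ ℕ.+ 1) + p₂ * X ^ σ + p₃ * X + p₄ ≡ 0#)

  -- Truncated subtraction is harmless: σ ≥ 1.
  [L*]^[σ-1] : Pred Carrier c
  [L*]^[σ-1] x = ∃ λ u → u ≢ 0# × x ≡ u ^ (σ ℕ.∸ 1)

  -- B(2,m,s,l,t), with L of order q = 2^m.
  B : Carrier → Quadruple → RawRingWithoutOne c c
  B l (p₁ , p₂ , p₃ , p₄) = record
    { Carrier = Carrier × Carrier
    ; _≈_     = _≡_
    ; _+_     = λ (a , b) (c , d) → a + c , b + d
    ; _*_     = λ (a , b) (c , d) →
        ( p₁ * a * c ^ σ + l * p₁ * a ^ σ * c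
        + p₂ * b * c ^ σ + l * p₂ * a ^ σ * d
        + p₃ * a * d ^ σ + l * p₃ * b ^ σ * c
        + p₄ * b * d ^ σ + l * p₄ * b ^ σ * d )
        , a * d + b * c
    ; -_      = λ (a , b) → - a , - b
    ; 0#      = 0# , 0#
    }

{-# OPTIONS --safe #-}

-- Write F(x,y) for the part of the first component of x ∘ y without the factor l,
-- and N(x) = F(x,x). Since char L = 2, x ∘ y = (F(x,y) + l F(y,x), det(x,y)). Elements
-- of the left nucleus of S correspond to pairs of additive maps (A, C) on L × L
-- with A(x) ∘ y = C(x ∘ y). Putting y = e x turns this into
-- C(ψ(e) N(x), 0) = A(x) ∘ e x, where ψ(e) = e^σ + l e is bijective exactly because l is not
-- a (σ−1)-th power. The map ψ is semilinear only over K₁ = Fix(σ), so unless the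
-- second component of C(·, 0) vanishes, all quotients N(x)/N(1,0) lie in K₁; this
-- is impossible, because X ↦ N(X,1)/p₁ is a polynomial of degree σ+1 without zeros
-- and (|K₁| − 1)(σ + 1) < |L|. Hence det(A(x), y) depends only on det(x, y), so A is
-- multiplication by some α ∈ L, and the same argument applied to the first
-- component of C(·, 0) gives α ∈ K₁. The right nucleus is treated alike, the
-- opposite multiplication having the same shape. Conversely K₁ acts on S by
-- central elements.
module Submission where

open import Defs
open import Algebra.Bundles using (CommutativeMonoid; CommutativeRing; RawRing; RawRingWithoutOne)
open import Algebra.Morphism.Structures using (module GroupMorphisms)
import Algebra.Properties.CommutativeMonoid.Sum as Sum
import Algebra.Properties.CommutativeSemiring.Exp as CExp
import Algebra.Properties.Semiring.Mult as Mult
import Algebra.Solver.Ring as RingSolver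
open import Algebra.Solver.Ring.AlmostCommutativeRing
  using (AlmostCommutativeRing; fromCommutativeSemiring; _-Raw-AlmostCommutative⟶_)
open import Algebra.Structures using (IsAbelianGroup)
open import Data.Bool.Base using (Bool; true; false; _xor_; _∧_)
open import Data.Fin.Base using (Fin; suc; zero; punchIn)
open import Data.Fin.Permutation using (Permutation′; permutation; _⟨$⟩ʳ_)
import Data.Fin.Properties as Fin
open import Data.List.Base using (List; []; _∷_; length; filter; map; tabulate; lookup)
open import Data.List.Membership.Propositional using (_∈_)
open import Data.List.Membership.Propositional.Properties
  using (∈-filter⁺; ∈-filter⁻; ∈-tabulate⁺; ∈-lookup; ∈-map⁻)
open import Data.List.Properties using (length-tabulate; length-map)
open import Data.List.Relation.Unary.All as All using (All; []; _∷_)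
import Data.List.Relation.Unary.All.Properties as All
open import Data.List.Relation.Unary.AllPairs using ([]; _∷_)
open import Data.List.Relation.Unary.Any as Any using (here; there; index)
open import Data.List.Relation.Unary.Any.Properties using (lookup-index)
open import Data.List.Relation.Unary.Unique.Propositional using (Unique)
import Data.List.Relation.Unary.Unique.Propositional.Properties as Unique
open import Data.Maybe.Base using (Maybe; just; nothing)
open import Data.Nat.Base as ℕ using (ℕ; zero; suc; _<_; _≤_; z≤n; s≤s)
open import Data.Nat.Divisibility using (_∣_; divides; ∣⇒≤; ∣m+n∣m⇒∣n)
open import Data.Nat.GCD
  using (gcd; gcd-GCD; module Bézout; gcd[m,n]∣m; gcd[m,n]∣n; gcd[m,n]≡0⇒m≡0)
import Data.Nat.Properties as ℕ
open import Data.Product.Base using (Σ; ∃; _×_; _,_; proj₁; proj₂)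
open import Data.Sum.Base using (_⊎_; inj₁; inj₂)
open import Function.Base using (_∘_; id)
open import Function.Bundles using (Inverse)
open import Level using (Level; 0ℓ)
open import Relation.Binary.Definitions using (DecidableEquality)
open import Relation.Binary.PropositionalEquality
open import Relation.Nullary using (¬_; Dec; yes; no; ¬?; contradiction)
open import Relation.Nullary.Decidable using (map′)
open import Relation.Unary using (Pred; Decidable; _≐_)

private
  variable
    a b c p : Level
    T : Set a
    T′ : Set b

-- Counting in lists by fibres

length-filter-¬? : {P : T → Set p} (P? : Decidable P) (xs : List T) →
  length xs ≡ length (filter P? xs) ℕ.+ length (filter (¬? ∘ P?) xs)
length-filter-¬? P? []       = refl
length-filter-¬? P? (x ∷ xs) with P? x
... | yes _ = cong suc (length-filter-¬? P? xs)
... | no  _ = trans (cong suc (length-filter-¬? P? xs)) (sym (ℕ.+-suc _ _))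

-- Induction on `ys`: the elements over the head form one fibre, of length at most `k`, and the
-- remaining ones map into the tail.
length≤fibres : DecidableEquality T′ → (f : T → T′) (k : ℕ) (ys : List T′) {xs : List T} →
  Unique xs → (∀ {x} → x ∈ xs → f x ∈ ys) →
  (∀ {y} → y ∈ ys → ∀ {zs} → Unique zs → All (λ z → f z ≡ y) zs → length zs ≤ k) →
  length xs ≤ length ys ℕ.* k
length≤fibres _≟_ f k [] {[]} _ _ _ = z≤n
length≤fibres _≟_ f k [] {x ∷ xs} _ f∈ _ with () ← f∈ (here refl)
length≤fibres _≟_ f k (y ∷ ys) {xs} xs! f∈ fibre =
  subst (_≤ _) (sym (length-filter-¬? P? xs)) (ℕ.+-mono-≤
    (fibre (here refl) (Unique.filter⁺ P? xs!) (All.all-filter P? xs))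
    (length≤fibres _≟_ f k ys (Unique.filter⁺ (¬? ∘ P?) xs!) rest (fibre ∘ there)))
  where
  P? : ∀ x → Dec (f x ≡ y)
  P? x = f x ≟ y

  rest : ∀ {x} → x ∈ filter (¬? ∘ P?) xs → f x ∈ ys
  rest x∈ with ∈-filter⁻ (¬? ∘ P?) x∈
  ... | x∈xs , fx≢y with f∈ x∈xs
  ...   | here fx≡y = contradiction fx≡y fx≢y
  ...   | there i   = i

-- The identity map has fibres of at most one element in a duplicate-free list.
⊆⇒length≤ : DecidableEquality T → {xs ys : List T} →
  Unique xs → (∀ {x} → x ∈ xs → x ∈ ys) → length xs ≤ length ys
⊆⇒length≤ _≟_ {ys = ys} xs! xs⊆ys = subst (_ ≤_) (ℕ.*-identityʳ _)
  (length≤fibres _≟_ id 1 ys xs! xs⊆ys λ _ → fibre)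
  where
  fibre : ∀ {y zs} → Unique zs → All (_≡ y) zs → length zs ≤ 1
  fibre {zs = []} _ _ = z≤n
  fibre {zs = _ ∷ []} _ _ = s≤s z≤n
  fibre {zs = _ ∷ _ ∷ _} ((z≢z′ ∷ _) ∷ _) (z≡ ∷ z′≡ ∷ _) =
    contradiction (trans z≡ (sym z′≡)) z≢z′

-- Finite fields: characteristic and Fermat's identity

module _ (M : CommutativeMonoid c p) where
  open CommutativeMonoid M using (_≈_; ε; Carrier; ∙-congˡ; identityʳ) renaming (trans to ≈-trans)
  open Sum M

  sum-single : ∀ {n} (f : Fin n → Carrier) (i : Fin n) →
    (∀ j → j ≢ i → f j ≈ ε) → sum f ≈ f i
  sum-single {suc n} f i f≈ε = ≈-trans (sum-remove {i = i} f) (≈-trans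
    (∙-congˡ (≈-trans (sum-cong-≋ (λ j → f≈ε (punchIn i j) (Fin.punchInᵢ≢i i j)))
                      (sum-replicate-zero n)))
    (identityʳ _))

module FiniteField {q : ℕ} (L : GF q c) where
  open GF L public
  open CommutativeRing commutativeRing public
    using ( +-comm; +-assoc; +-identityˡ; +-identityʳ; -‿inverseˡ; -‿inverseʳ
          ; *-comm; *-assoc; *-identityˡ; *-identityʳ; zeroˡ; zeroʳ; distribˡ
          ; +-commutativeMonoid; *-commutativeMonoid; commutativeSemiring)
  open CExp commutativeSemiring public using (^-assocʳ; ^-distrib-*)
  private
    module Order = Inverse order
    module + = Sum +-commutativeMonoid
    module × = Sum *-commutativeMonoid

  infix 4 _≟_
  _≟_ : DecidableEquality Carrier
  x ≟ y = map′ inj (cong Order.to) (Order.to x Fin.≟ Order.to y)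
    where
    inj : Order.to x ≡ Order.to y → x ≡ y
    inj eq = trans (sym (Order.strictlyInverseʳ x))
             (trans (cong Order.from eq) (Order.strictlyInverseʳ y))

  elements : List Carrier
  elements = tabulate Order.from

  length-elements : length elements ≡ q
  length-elements = length-tabulate Order.from

  ∈-elements : ∀ x → x ∈ elements
  ∈-elements x = subst (_∈ elements) (Order.strictlyInverseʳ x) (∈-tabulate⁺ {f = Order.from} (Order.to x))

  elements-unique : Unique elements
  elements-unique = Unique.tabulate⁺ λ {i} {j} eq →
    trans (sym (Order.strictlyInverseˡ i)) (trans (cong Order.to eq) (Order.strictlyInverseˡ j))

  -- Were `y` missed, `y ∷ map f elements` would be a duplicate-free list longer than `elements`.
  injective⇒surjective : (f : Carrier → Carrier) →
    (∀ {x y} → f x ≡ f y → x ≡ y) → ∀ y → ∃ λ x → f x ≡ y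
  injective⇒surjective f inj y with Any.any? (y ≟_) (map f elements)
  ... | yes y∈ = let x , _ , y≡fx = ∈-map⁻ f y∈ in x , sym y≡fx
  ... | no  y∉ = contradiction
    (subst (_≤ length elements) (cong suc (length-map f elements))
      (⊆⇒length≤ _≟_ (All.¬Any⇒All¬ _ y∉ ∷ Unique.map⁺ inj elements-unique)
                     (λ {x} _ → ∈-elements x)))
    ℕ.1+n≰n

  *-cancelˡ : ∀ {x y z} → x ≢ 0# → x * y ≡ x * z → y ≡ z
  *-cancelˡ {x} {y} {z} x≢0 xy≡xz = let x⁻¹ , xx⁻¹≡1 = inverse x x≢0 in begin
    y              ≡⟨ *-identityˡ y ⟨
    1# * y         ≡⟨ cong (_* y) (trans (sym xx⁻¹≡1) (*-comm x x⁻¹)) ⟩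
    x⁻¹ * x * y    ≡⟨ *-assoc x⁻¹ x y ⟩
    x⁻¹ * (x * y)  ≡⟨ cong (x⁻¹ *_) xy≡xz ⟩
    x⁻¹ * (x * z)  ≡⟨ *-assoc x⁻¹ x z ⟨
    x⁻¹ * x * z    ≡⟨ cong (_* z) (trans (sym xx⁻¹≡1) (*-comm x x⁻¹)) ⟨
    1# * z         ≡⟨ *-identityˡ z ⟩
    z              ∎
    where open ≡-Reasoning

  x*y≡0⇒ : ∀ {x y} → x * y ≡ 0# → x ≡ 0# ⊎ y ≡ 0#
  x*y≡0⇒ {x} {y} xy≡0 with x ≟ 0#
  ... | yes x≡0 = inj₁ x≡0
  ... | no  x≢0 = inj₂ (*-cancelˡ x≢0 (trans xy≡0 (sym (zeroʳ x))))

  *-nonZero : ∀ {x y} → x ≢ 0# → y ≢ 0# → x * y ≢ 0#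
  *-nonZero x≢0 y≢0 xy≡0 with x*y≡0⇒ xy≡0
  ... | inj₁ x≡0 = x≢0 x≡0
  ... | inj₂ y≡0 = y≢0 y≡0

  *-cancelʳ : ∀ {x y z} → x ≢ 0# → y * x ≡ z * x → y ≡ z
  *-cancelʳ x≢0 eq = *-cancelˡ x≢0 (trans (*-comm _ _) (trans eq (*-comm _ _)))

  private
    reindex : (f g : Carrier → Carrier) → (∀ x → f (g x) ≡ x) → (∀ x → g (f x) ≡ x) → Permutation′ q
    reindex f g fg gf = permutation (Order.to ∘ f ∘ Order.from) (Order.to ∘ g ∘ Order.from)
      (λ i → trans (cong (Order.to ∘ f) (Order.strictlyInverseʳ _))
                   (trans (cong Order.to (fg _)) (Order.strictlyInverseˡ i)))
      (λ i → trans (cong (Order.to ∘ g) (Order.strictlyInverseʳ _))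
                   (trans (cong Order.to (gf _)) (Order.strictlyInverseˡ i)))

  open Mult semiring using (×1-homo-*) renaming (_×_ to _•_) public

  -- Translation by 1 permutes the field, so the sum of all elements does not change when 1 is added
  -- to each of the `q` summands.
  order•1≡0 : q • 1# ≡ 0#
  order•1≡0 = begin
    q • 1#                 ≡⟨ +-identityʳ _ ⟨
    q • 1# + 0#            ≡⟨ cong (q • 1# +_) (-‿inverseʳ Σx) ⟨
    q • 1# + (Σx + - Σx)   ≡⟨ +-assoc _ _ _ ⟨
    q • 1# + Σx + - Σx     ≡⟨ cong (_+ - Σx) shift ⟨
    Σx + - Σx              ≡⟨ -‿inverseʳ Σx ⟩
    0#                     ∎
    where
    open ≡-Reasoning
    Σx : Carrier
    Σx = +.sum Order.from

    π : Permutation′ q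
    π = reindex (1# +_) (- 1# +_)
      (λ x → trans (sym (+-assoc _ _ x)) (trans (cong (_+ x) (-‿inverseʳ 1#)) (+-identityˡ x)))
      (λ x → trans (sym (+-assoc _ _ x)) (trans (cong (_+ x) (-‿inverseˡ 1#)) (+-identityˡ x)))

    shift : Σx ≡ q • 1# + Σx
    shift = begin
      Σx                                   ≡⟨ +.sum-permute Order.from π ⟩
      +.sum (Order.from ∘ (π ⟨$⟩ʳ_))       ≡⟨ +.sum-cong-≗ {n = q} (λ i → Order.strictlyInverseʳ _) ⟩
      +.sum (λ i → 1# + Order.from i)      ≡⟨ +.∑-distrib-+ {n = q} (λ _ → 1#) Order.from ⟩
      +.sum {q} (λ _ → 1#) + Σx            ≡⟨ cong (_+ Σx) (+.sum-replicate q) ⟩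
      q • 1# + Σx                          ∎

  1≢0 : 1# ≢ 0#
  1≢0 = 0≢1 ∘ sym

  -- For `x` nonzero, multiplication by `x` permutes the field. To keep the product over all
  -- elements nonzero, `unit` replaces 0 by 1; `defect` records the resulting mismatch, a single
  -- factor `x` at 0. Hence `x ^ q * Π` equals `x * Π`, and `Π` cancels.
  x^order≡x : ∀ x → x ^ q ≡ x
  x^order≡x x with x ≟ 0#
  -- An element of `Fin q` rules out `q = 0`, where the power would be 1.
  ... | yes refl = 0^ q (Order.to 0#)
    where
    0^ : ∀ n → Fin n → 0# ^ n ≡ 0#
    0^ (suc n) _ = zeroˡ _
  ... | no x≢0 = *-cancelʳ (Π-nonZero q (unit≢0 ∘ Order.from)) (begin
    x ^ q * Π                               ≡⟨ cong (_* Π) (×.sum-replicate q) ⟨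
    ×.sum {q} (λ _ → x) * Π                 ≡⟨ ×.∑-distrib-+ {n = q} (λ _ → x) (unit ∘ Order.from) ⟨
    ×.sum {q} (λ i → x * unit (from i))     ≡⟨ ×.sum-cong-≗ {n = q} (absorb ∘ from) ⟩
    ×.sum {q} (λ i → defect (from i) * unit (x * from i))
      ≡⟨ ×.∑-distrib-+ {n = q} (defect ∘ from) (λ i → unit (x * from i)) ⟩
    ×.sum {q} (defect ∘ from) * ×.sum {q} (λ i → unit (x * from i))
      ≡⟨ cong₂ _*_ Πdefect (trans
           (×.sum-cong-≗ {n = q} (λ i → cong unit (sym (Order.strictlyInverseʳ _))))
           (sym (×.sum-permute (unit ∘ from) π))) ⟩
    x * Π                                   ∎)
    where
    open ≡-Reasoning
    from : Fin q → Carrier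
    from = Order.from

    unit defect : Carrier → Carrier
    unit y with y ≟ 0#
    ... | yes _ = 1#
    ... | no  _ = y
    defect y with y ≟ 0#
    ... | yes _ = x
    ... | no  _ = 1#

    Π : Carrier
    Π = ×.sum (unit ∘ from)

    unit≢0 : ∀ y → unit y ≢ 0#
    unit≢0 y with y ≟ 0#
    ... | yes _   = 1≢0
    ... | no  y≢0 = y≢0

    Π-nonZero : ∀ n {f : Fin n → Carrier} → (∀ i → f i ≢ 0#) → ×.sum f ≢ 0#
    Π-nonZero zero    f≢0 = 1≢0
    Π-nonZero (suc n) f≢0 = *-nonZero (f≢0 zero) (Π-nonZero n (f≢0 ∘ suc))

    absorb : ∀ y → x * unit y ≡ defect y * unit (x * y)
    absorb y with y ≟ 0# | x * y ≟ 0#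
    ... | yes _    | yes _    = refl
    ... | yes refl | no xy≢0  = contradiction (zeroʳ x) xy≢0
    ... | no y≢0   | yes xy≡0 = contradiction xy≡0 (*-nonZero x≢0 y≢0)
    ... | no _     | no _     = sym (*-identityˡ _)

    Πdefect : ×.sum (defect ∘ from) ≡ x
    Πdefect = trans (sum-single *-commutativeMonoid (defect ∘ from) (Order.to 0#) others) zero-case
      where
      zero-case : defect (from (Order.to 0#)) ≡ x
      zero-case with from (Order.to 0#) ≟ 0#
      ... | yes _  = refl
      ... | no  ≢0 = contradiction (Order.strictlyInverseʳ 0#) ≢0
      others : ∀ j → j ≢ Order.to 0# → defect (from j) ≡ 1#
      others j j≢ with from j ≟ 0#
      ... | yes eq = contradiction (trans (sym (Order.strictlyInverseˡ j)) (cong Order.to eq)) j≢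
      ... | no  _  = refl

    x⁻¹ : Carrier
    x⁻¹ = proj₁ (inverse x x≢0)

    π : Permutation′ q
    π = reindex (x *_) (x⁻¹ *_)
      (λ y → trans (sym (*-assoc _ _ y))
             (trans (cong (_* y) (proj₂ (inverse x x≢0))) (*-identityˡ y)))
      (λ y → trans (sym (*-assoc _ _ y))
             (trans (cong (_* y) (trans (*-comm _ _) (proj₂ (inverse x x≢0)))) (*-identityˡ y)))

-- Fields of order 2^m: Frobenius powers and their fixed elements

module BinaryField {m : ℕ} (L : GF (2 ℕ.^ m) c) where
  open FiniteField L public

  -- The multiple `2 ^ m • 1#` is a product of `m` copies of 1 + 1. It vanishes and there are no
  -- zero divisors, so one factor vanishes; an empty product would give 1 = 0.
  1+1≡0 : 1# + 1# ≡ 0#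
  1+1≡0 = trans (cong (1# +_) (sym (+-identityʳ 1#))) (halve m order•1≡0)
    where
    halve : ∀ k → (2 ℕ.^ k) • 1# ≡ 0# → 2 • 1# ≡ 0#
    halve zero    eq = contradiction (trans (sym (+-identityʳ 1#)) eq) 1≢0
    halve (suc k) eq with x*y≡0⇒ (trans (sym (×1-homo-* 2 (2 ℕ.^ k))) eq)
    ... | inj₁ 2≡0 = 2≡0
    ... | inj₂ eq′ = halve k eq′

  x+x≡0 : ∀ x → x + x ≡ 0#
  x+x≡0 x = begin
    x + x            ≡⟨ cong₂ _+_ (*-identityʳ x) (*-identityʳ x) ⟨
    x * 1# + x * 1#  ≡⟨ distribˡ x 1# 1# ⟨
    x * (1# + 1#)    ≡⟨ cong (x *_) 1+1≡0 ⟩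
    x * 0#           ≡⟨ zeroʳ x ⟩
    0#               ∎
    where open ≡-Reasoning

  private
    𝔽₂ : RawRing 0ℓ 0ℓ
    𝔽₂ = record { Carrier = Bool ; _≈_ = _≡_ ; _+_ = _xor_ ; _*_ = _∧_ ; -_ = id
                ; 0# = false ; 1# = true }

    R : AlmostCommutativeRing c c
    R = fromCommutativeSemiring commutativeSemiring

    𝔽₂⟶L : 𝔽₂ -Raw-AlmostCommutative⟶ R
    𝔽₂⟶L = record
      { ⟦_⟧    = ⟦_⟧
      ; +-homo = λ { false false → sym (+-identityʳ 0#) ; false true → sym (+-identityˡ 1#)
                   ; true false → sym (+-identityʳ 1#) ; true true → sym 1+1≡0 }
      ; *-homo = λ { false y → sym (zeroˡ ⟦ y ⟧) ; true y → sym (*-identityˡ ⟦ y ⟧) }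
      ; -‿homo = λ _ → refl
      ; 0-homo = refl
      ; 1-homo = refl
      }
      where
      ⟦_⟧ : Bool → Carrier
      ⟦ false ⟧ = 0#
      ⟦ true  ⟧ = 1#

    open _-Raw-AlmostCommutative⟶_ 𝔽₂⟶L using (⟦_⟧)

    _coeff≟_ : ∀ x y → Maybe (⟦ x ⟧ ≡ ⟦ y ⟧)
    false coeff≟ false = just refl
    true  coeff≟ true  = just refl
    _     coeff≟ _     = nothing

  -- With coefficients in 𝔽₂ the solver also cancels x + x.
  open RingSolver 𝔽₂ R 𝔽₂⟶L _coeff≟_ public using (solve; _:=_; _:+_; _:*_; con)

  x+y≡0⇒x≡y : ∀ {x y} → x + y ≡ 0# → x ≡ y
  x+y≡0⇒x≡y {x} {y} eq = trans (solve 2 (λ x y → x := (x :+ y) :+ y) refl x y)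
                         (trans (cong (_+ y) eq) (+-identityˡ y))

  x≡y⇒x+y≡0 : ∀ {x y} → x ≡ y → x + y ≡ 0#
  x≡y⇒x+y≡0 refl = x+x≡0 _

  x≢y⇒x+y≢0 : ∀ {x y} → x ≢ y → x + y ≢ 0#
  x≢y⇒x+y≢0 x≢y = x≢y ∘ x+y≡0⇒x≡y

  -x≡x : ∀ x → - x ≡ x
  -x≡x x = x+y≡0⇒x≡y (-‿inverseˡ x)

  frob : ℕ → Carrier → Carrier
  frob k x = x ^ (2 ℕ.^ k)

  private
    ^2 : ∀ x → x ^ 2 ≡ x * x
    ^2 x = cong (x *_) (*-identityʳ x)

  frob-suc : ∀ k x → frob (suc k) x ≡ frob k x * frob k x
  frob-suc k x = trans (cong (x ^_) (ℕ.*-comm 2 (2 ℕ.^ k)))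
    (trans (sym (^-assocʳ x (2 ℕ.^ k) 2)) (^2 _))

  frob-0 : ∀ x → frob 0 x ≡ x
  frob-0 = *-identityʳ

  frob-1# : ∀ k → frob k 1# ≡ 1#
  frob-1# zero    = *-identityʳ 1#
  frob-1# (suc k) = trans (frob-suc k 1#)
    (trans (cong₂ _*_ (frob-1# k) (frob-1# k)) (*-identityʳ 1#))

  frob-+ : ∀ k x y → frob k (x + y) ≡ frob k x + frob k y
  frob-+ zero    x y = trans (frob-0 _) (cong₂ _+_ (sym (frob-0 x)) (sym (frob-0 y)))
  frob-+ (suc k) x y = begin
    frob (suc k) (x + y)                           ≡⟨ frob-suc k _ ⟩
    frob k (x + y) * frob k (x + y)                ≡⟨ cong₂ _*_ (frob-+ k x y) (frob-+ k x y) ⟩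
    (frob k x + frob k y) * (frob k x + frob k y)
      ≡⟨ solve 2 (λ x y → (x :+ y) :* (x :+ y) := x :* x :+ y :* y) refl (frob k x) (frob k y) ⟩
    frob k x * frob k x + frob k y * frob k y      ≡⟨ cong₂ _+_ (frob-suc k x) (frob-suc k y) ⟨
    frob (suc k) x + frob (suc k) y                ∎
    where open ≡-Reasoning

  frob-* : ∀ k x y → frob k (x * y) ≡ frob k x * frob k y
  frob-* k x y = ^-distrib-* x y (2 ℕ.^ k)

  frob-∘ : ∀ j k x → frob j (frob k x) ≡ frob (k ℕ.+ j) x
  frob-∘ j k x = trans (^-assocʳ x (2 ℕ.^ k) (2 ℕ.^ j))
    (cong (x ^_) (sym (ℕ.^-distribˡ-+-* 2 k j)))

  frob-0# : ∀ k → frob k 0# ≡ 0#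
  frob-0# k = begin
    frob k 0#              ≡⟨ cong (frob k) (x+x≡0 0#) ⟨
    frob k (0# + 0#)       ≡⟨ frob-+ k 0# 0# ⟩
    frob k 0# + frob k 0#  ≡⟨ x+x≡0 _ ⟩
    0#                     ∎
    where open ≡-Reasoning

  frob-m : ∀ x → frob m x ≡ x
  frob-m = x^order≡x

  Fixed : ℕ → Carrier → Set c
  Fixed k x = frob k x ≡ x

  Fixed-*ˡ : ∀ {k x} n → Fixed k x → Fixed (n ℕ.* k) x
  Fixed-*ˡ {k} {x} zero    fx = frob-0 x
  Fixed-*ˡ {k} {x} (suc n) fx =
    trans (sym (frob-∘ (n ℕ.* k) k x)) (trans (cong (frob (n ℕ.* k)) fx) (Fixed-*ˡ n fx))

  Fixed-∣ : ∀ {k n x} → k ∣ n → Fixed k x → Fixed n x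
  Fixed-∣ (divides r refl) = Fixed-*ˡ r

  Fixed-+⁻ : ∀ k n {x} → Fixed (k ℕ.+ n) x → Fixed n x → Fixed k x
  Fixed-+⁻ k n {x} fk+n fn = begin
    frob k x            ≡⟨ cong (frob k) fn ⟨
    frob k (frob n x)   ≡⟨ frob-∘ k n x ⟩
    frob (n ℕ.+ k) x    ≡⟨ cong (λ e → frob e x) (ℕ.+-comm n k) ⟩
    frob (k ℕ.+ n) x    ≡⟨ fk+n ⟩
    x                   ∎
    where open ≡-Reasoning

  -- Bézout: one of a multiple of `k` and a multiple of `n` is the other plus the gcd. Both
  -- multiples fix `x`, and `Fixed-+⁻` subtracts them.
  Fixed-gcd : ∀ {k n x} → Fixed k x → Fixed n x → Fixed (gcd k n) x
  Fixed-gcd {k} {n} {x} fk fn with Bézout.identity (gcd-GCD k n)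
  ... | Bézout.+- i j eq = Fixed-+⁻ (gcd k n) (j ℕ.* n)
    (subst (λ e → Fixed e x) (sym eq) (Fixed-*ˡ i fk)) (Fixed-*ˡ j fn)
  ... | Bézout.-+ i j eq = Fixed-+⁻ (gcd k n) (i ℕ.* k)
    (subst (λ e → Fixed e x) (sym eq) (Fixed-*ˡ j fn)) (Fixed-*ˡ i fk)

  -- Polynomial functions and the number of their zeros

  -- f is a polynomial function of formal degree n; a, its coefficient at Xⁿ, may be 0.
  data Poly (a : Carrier) : ℕ → (Carrier → Carrier) → Set c where
    const  : ∀ {f} → (∀ x → f x ≡ a) → Poly a 0 f
    horner : ∀ {n f g} e → Poly a n g → (∀ x → f x ≡ e + x * g x) → Poly a (suc n) f

  poly-cong : ∀ {a n f g} → (∀ x → g x ≡ f x) → Poly a n f → Poly a n g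
  poly-cong g≗f (const f≡)      = const λ x → trans (g≗f x) (f≡ x)
  poly-cong g≗f (horner e h f≡) = horner e h λ x → trans (g≗f x) (f≡ x)

  poly-+ : ∀ {a b n f g} → Poly a n f → Poly b n g → Poly (a + b) n (λ x → f x + g x)
  poly-+ (const f≡) (const g≡) = const λ x → cong₂ _+_ (f≡ x) (g≡ x)
  poly-+ (horner {g = h} e p f≡) (horner {g = h′} e′ p′ g≡) = horner (e + e′) (poly-+ p p′) λ x →
    trans (cong₂ _+_ (f≡ x) (g≡ x))
      (solve 5 (λ x e e′ h h′ → (e :+ x :* h) :+ (e′ :+ x :* h′) := (e :+ e′) :+ x :* (h :+ h′))
        refl x e e′ (h x) (h′ x))

  poly-scale : ∀ {a n f} k → Poly a n f → Poly (k * a) n (λ x → k * f x)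
  poly-scale k (const f≡) = const λ x → cong (k *_) (f≡ x)
  poly-scale k (horner {g = h} e p f≡) = horner (k * e) (poly-scale k p) λ x →
    trans (cong (k *_) (f≡ x))
      (solve 4 (λ k x e h → k :* (e :+ x :* h) := k :* e :+ x :* (k :* h)) refl k x e (h x))

  -- Summands in `poly-+` must have the same formal degree, so shorter polynomials are padded with
  -- zero leading coefficients.
  poly-suc : ∀ {a n f} → Poly a n f → Poly 0# (suc n) f
  poly-suc {a} (const f≡) = horner a (const {f = λ _ → 0#} λ _ → refl) λ x →
    trans (f≡ x) (sym (trans (cong (a +_) (zeroʳ x)) (+-identityʳ a)))
  poly-suc (horner e p f≡) = horner e (poly-suc p) f≡

  poly-< : ∀ {a n k f} → n < k → Poly a n f → Poly 0# k f
  poly-< n<k p = poly-<′ (ℕ.≤⇒≤′ n<k) p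
    where
    poly-<′ : ∀ {a n k f} → suc n ℕ.≤′ k → Poly a n f → Poly 0# k f
    poly-<′ (ℕ.≤′-reflexive refl)  p = poly-suc p
    poly-<′ (ℕ.≤′-step n<k) p = poly-suc (poly-<′ n<k p)

  poly-^ : ∀ n → Poly 1# n (_^ n)
  poly-^ zero    = const λ _ → refl
  poly-^ (suc n) = horner 0# (poly-^ n) λ x → sym (+-identityˡ _)

  -- Division by X - r, which is X + r in characteristic 2. From f = e + X h and h = h(r) + (X + r)
  -- h′ one gets the quotient h + r h′, whose leading coefficient is that of h since h′ has smaller
  -- degree.
  poly-divide : ∀ {a n f} r → Poly a (suc n) f →
    ∃ λ g → Poly a n g × (∀ x → f x ≡ f r + (x + r) * g x)
  poly-divide {a} {f = f} r (horner {g = h} e p@(const h≡) f≡) = h , p , λ x → begin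
    f x                            ≡⟨ f≡ x ⟩
    e + x * h x                    ≡⟨ cong (λ z → e + x * z) (h≡ x) ⟩
    e + x * a
      ≡⟨ solve 4 (λ e x r a → e :+ x :* a := (e :+ r :* a) :+ (x :+ r) :* a) refl e x r a ⟩
    e + r * a + (x + r) * a        ≡⟨ cong₂ (λ y z → e + r * y + (x + r) * z) (h≡ r) (h≡ x) ⟨
    e + r * h r + (x + r) * h x    ≡⟨ cong (_+ (x + r) * h x) (f≡ r) ⟨
    f r + (x + r) * h x            ∎
    where open ≡-Reasoning
  poly-divide {a} {f = f} r (horner {g = h} e p@(horner _ _ _) f≡) with poly-divide r p
  ... | h′ , p′ , h≡ = (λ x → h x + r * h′ x) ,
    subst (λ b → Poly b _ _) (+-identityʳ a) (poly-+ p (poly-suc (poly-scale r p′))) , λ x → begin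
    f x                                      ≡⟨ f≡ x ⟩
    e + x * h x                              ≡⟨ cong (λ z → e + x * z) (h≡ x) ⟩
    e + x * (h r + (x + r) * h′ x)
      ≡⟨ solve 5 (λ e x r y z → e :+ x :* (y :+ (x :+ r) :* z)
            := (e :+ r :* y) :+ (x :+ r) :* ((y :+ (x :+ r) :* z) :+ r :* z))
          refl e x r (h r) (h′ x) ⟩
    e + r * h r + (x + r) * (h r + (x + r) * h′ x + r * h′ x)
      ≡⟨ cong₂ (λ y z → y + (x + r) * (z + r * h′ x)) (f≡ r) (h≡ x) ⟨
    f r + (x + r) * (h x + r * h′ x)         ∎
    where open ≡-Reasoning

  -- Dividing by X + r for one root r leaves the other roots as roots of the quotient, with the same
  -- leading coefficient and degree one less.
  length-roots : ∀ {a n f xs} → a ≢ 0# → Poly a n f →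
    Unique xs → All (λ x → f x ≡ 0#) xs → length xs ≤ n
  length-roots a≢0 p [] [] = z≤n
  length-roots a≢0 (const f≡) (_ ∷ _) (fx≡0 ∷ _) = contradiction (trans (sym (f≡ _)) fx≡0) a≢0
  length-roots {f = f} {r ∷ _} a≢0 p@(horner _ _ _) (r∉ ∷ xs!) (fr≡0 ∷ fxs≡0) with poly-divide r p
  ... | g , q , f≡ = s≤s (length-roots a≢0 q xs! (All.zipWith root (r∉ , fxs≡0)))
    where
    root : ∀ {x} → r ≢ x × f x ≡ 0# → g x ≡ 0#
    root {x} (r≢x , fx≡0) with x*y≡0⇒ {x + r} {g x} (begin
      (x + r) * g x        ≡⟨ +-identityˡ _ ⟨
      0# + (x + r) * g x   ≡⟨ cong (_+ (x + r) * g x) fr≡0 ⟨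
      f r + (x + r) * g x  ≡⟨ f≡ x ⟨
      f x                  ≡⟨ fx≡0 ⟩
      0#                   ∎)
      where open ≡-Reasoning
    ... | inj₁ x+r≡0 = contradiction (sym (x+y≡0⇒x≡y x+r≡0)) r≢x
    ... | inj₂ gx≡0  = gx≡0

-- Orders of the fixed fields of Frobenius powers

lookup-injective : {xs : List T} → Unique xs →
  ∀ {i j} → lookup xs i ≡ lookup xs j → i ≡ j
lookup-injective (_  ∷ _)   {zero}  {zero}  _  = refl
lookup-injective (x∉ ∷ _)   {zero}  {suc j} eq = contradiction eq (All.lookup x∉ (∈-lookup j))
lookup-injective (x∉ ∷ _)   {suc i} {zero}  eq = contradiction (sym eq) (All.lookup x∉ (∈-lookup i))
lookup-injective (_  ∷ xs!) {suc i} {suc j} eq = cong suc (lookup-injective xs! eq)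

module FixedField {m : ℕ} (L : GF (2 ℕ.^ m) c) where
  open BinaryField {m = m} L public

  fixed : ℕ → List Carrier
  fixed k = filter (λ x → frob k x ≟ x) elements

  fixed-unique : ∀ k → Unique (fixed k)
  fixed-unique k = Unique.filter⁺ (λ x → frob k x ≟ x) elements-unique

  ∈-fixed⁺ : ∀ k {x} → Fixed k x → x ∈ fixed k
  ∈-fixed⁺ k fx = ∈-filter⁺ (λ x → frob k x ≟ x) (∈-elements _) fx

  ∈-fixed⁻ : ∀ k {x} → x ∈ fixed k → Fixed k x
  ∈-fixed⁻ k x∈ = proj₂ (∈-filter⁻ (λ x → frob k x ≟ x) {xs = elements} x∈)

  private
    1<2^ : ∀ {k} → 0 < k → 1 < 2 ℕ.^ k
    1<2^ = ℕ.^-monoʳ-< 2 (s≤s (s≤s z≤n))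

    poly-id : Poly 1# 1 id
    poly-id = poly-cong (sym ∘ *-identityʳ) (poly-^ 1)

  -- The fixed elements are zeros of X^(2^k) + X. For k > 0 the exponent exceeds 1, so the term X
  -- cannot cancel the leading one.
  length-fixed-≤ : ∀ {k} → 0 < k → length (fixed k) ≤ 2 ℕ.^ k
  length-fixed-≤ {k} 0<k = length-roots {f = λ x → frob k x + x} (1≢0 ∘ trans (sym (+-identityʳ 1#)))
    (poly-+ (poly-^ (2 ℕ.^ k)) (poly-< (1<2^ 0<k) poly-id))
    (fixed-unique k) (All.tabulate (x≡y⇒x+y≡0 ∘ ∈-fixed⁻ k))

  -- Otherwise a polynomial of degree 2^k would have 2^m > 2^k zeros.
  ¬allFixed : ∀ {k} → 0 < k → k < m → ¬ (∀ x → Fixed k x)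
  ¬allFixed {k} 0<k k<m fix = ℕ.<⇒≱ (ℕ.^-monoʳ-< 2 (s≤s (s≤s z≤n)) k<m)
    (subst (_≤ 2 ℕ.^ k) length-elements
      (ℕ.≤-trans (⊆⇒length≤ _≟_ elements-unique (λ {x} _ → ∈-fixed⁺ k (fix x)))
                 (length-fixed-≤ 0<k)))

  -- The trace onto the fixed field of frob g when m = r * g.
  trace : ℕ → ℕ → Carrier → Carrier
  trace g zero    x = 0#
  trace g (suc r) x = trace g r x + frob (r ℕ.* g) x

  private
    -- For g > 0 the exponents 2^(r g) increase strictly, so the last summand of the trace provides
    -- the leading term, with coefficient 1.
    poly-trace : ∀ {g} → 0 < g → ∀ r → Poly 0# (2 ℕ.^ (r ℕ.* g)) (trace g r)
    poly-trace-suc : ∀ {g} → 0 < g → ∀ r → Poly 1# (2 ℕ.^ (r ℕ.* g)) (trace g (suc r))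

    poly-trace 0<g zero    = poly-suc (const λ _ → refl)
    poly-trace {g} 0<g (suc r) = poly-<
      (ℕ.^-monoʳ-< 2 (s≤s (s≤s z≤n)) (ℕ.+-monoˡ-≤ (r ℕ.* g) 0<g))
      (poly-trace-suc 0<g r)

    poly-trace-suc {g} 0<g r =
      subst (λ a → Poly a (2 ℕ.^ (r ℕ.* g)) (trace g (suc r))) (+-identityˡ 1#)
        (poly-+ {f = trace g r} {g = frob (r ℕ.* g)} (poly-trace 0<g r) (poly-^ _))

  trace-telescope : ∀ g r x → trace g r (frob g x + x) ≡ frob (r ℕ.* g) x + x
  trace-telescope g zero    x = sym (x≡y⇒x+y≡0 (frob-0 x))
  trace-telescope g (suc r) x = begin
    trace g r (frob g x + x) + frob (r ℕ.* g) (frob g x + x)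
      ≡⟨ cong₂ _+_ (trace-telescope g r x) (frob-+ (r ℕ.* g) _ _) ⟩
    frob (r ℕ.* g) x + x + (frob (r ℕ.* g) (frob g x) + frob (r ℕ.* g) x)
      ≡⟨ solve 3 (λ y x z → (y :+ x) :+ (z :+ y) := z :+ x) refl
             (frob (r ℕ.* g) x) x (frob (r ℕ.* g) (frob g x)) ⟩
    frob (r ℕ.* g) (frob g x) + x
      ≡⟨ cong (_+ x) (frob-∘ (r ℕ.* g) g x) ⟩
    frob (g ℕ.+ r ℕ.* g) x + x  ∎
    where open ≡-Reasoning

  -- x ↦ x^(2^g) + x maps L into the zeros of the trace, of which there are at
  -- most 2^(m-g), and its fibres are translates of the fixed field.
  length-fixed-≥ : ∀ {g} → 0 < m → 0 < g → g ∣ m → 2 ℕ.^ g ≤ length (fixed g)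
  length-fixed-≥ 0<m 0<g (divides zero m≡0) = contradiction m≡0 (ℕ.>⇒≢ 0<m)
  length-fixed-≥ {g} 0<m 0<g (divides (suc r) m≡) =
    ℕ.*-cancelˡ-≤ (2 ℕ.^ (r ℕ.* g)) {{ℕ.m^n≢0 2 (r ℕ.* g)}} (begin
      2 ℕ.^ (r ℕ.* g) ℕ.* 2 ℕ.^ g       ≡⟨ ℕ.*-comm (2 ℕ.^ (r ℕ.* g)) (2 ℕ.^ g) ⟩
      2 ℕ.^ g ℕ.* 2 ℕ.^ (r ℕ.* g)       ≡⟨ ℕ.^-distribˡ-+-* 2 g (r ℕ.* g) ⟨
      2 ℕ.^ (g ℕ.+ r ℕ.* g)             ≡⟨ cong (2 ℕ.^_) m≡ ⟨
      2 ℕ.^ m                           ≡⟨ length-elements ⟨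
      length elements                   ≤⟨ length≤fibres _≟_ (λ x → frob g x + x) (length (fixed g)) zeros
                                             elements-unique (λ {x} _ → image x) (λ _ → fibre) ⟩
      length zeros ℕ.* length (fixed g) ≤⟨ ℕ.*-monoˡ-≤ (length (fixed g))
                                             (length-roots 1≢0 (poly-trace-suc 0<g r)
                                               (Unique.filter⁺ tr? elements-unique)
                                               (All.all-filter tr? elements)) ⟩
      2 ℕ.^ (r ℕ.* g) ℕ.* length (fixed g) ∎)
    where
    open ℕ.≤-Reasoning
    tr? : ∀ x → Dec (trace g (suc r) x ≡ 0#)
    tr? x = trace g (suc r) x ≟ 0#

    zeros : List Carrier
    zeros = filter tr? elements

    image : ∀ x → frob g x + x ∈ zeros
    image x = ∈-filter⁺ tr? (∈-elements _) (trans (trace-telescope g (suc r) x)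
      (x≡y⇒x+y≡0 (trans (cong (λ k → frob k x) (sym m≡)) (frob-m x))))

    fibre : ∀ {y zs} → Unique zs → All (λ z → frob g z + z ≡ y) zs → length zs ≤ length (fixed g)
    fibre {zs = []}         _   _          = z≤n
    fibre {zs = zs@(z ∷ _)} zs! zs≡@(z≡ ∷ _) = subst (_≤ length (fixed g)) (length-map (z +_) zs)
      (⊆⇒length≤ _≟_ (Unique.map⁺ cancel zs!) translate)
      where
      cancel : ∀ {x y} → z + x ≡ z + y → x ≡ y
      cancel {x} {y} eq = trans (solve 2 (λ z x → x := z :+ (z :+ x)) refl z x)
        (trans (cong (z +_) eq) (solve 2 (λ z x → z :+ (z :+ x) := x) refl z y))

      translate : ∀ {x} → x ∈ map (z +_) zs → x ∈ fixed g
      translate x∈ with ∈-map⁻ (z +_) x∈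
      ... | w , w∈ , refl = ∈-fixed⁺ g (trans (frob-+ g z w) (x+y≡0⇒x≡y (trans
        (solve 4 (λ fz fw z w → (fz :+ fw) :+ (z :+ w) := (fz :+ z) :+ (fw :+ w)) refl
          (frob g z) (frob g w) z w)
        (x≡y⇒x+y≡0 (trans z≡ (sym (All.lookup zs≡ w∈)))))))

  length-fixed : ∀ {g} → 0 < m → 0 < g → g ∣ m → length (fixed g) ≡ 2 ℕ.^ g
  length-fixed 0<m 0<g g∣m = ℕ.≤-antisym (length-fixed-≤ 0<g) (length-fixed-≥ 0<m 0<g g∣m)

  fixedField : ℕ → Subfield L
  fixedField k = record
    { Member    = Fixed k
    ; isSubring = record
      { +-closed  = λ fx fy → trans (frob-+ k _ _) (cong₂ _+_ fx fy)
      ; *-closed  = λ fx fy → trans (frob-* k _ _) (cong₂ _*_ fx fy)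
      ; -‿closed  = λ fx → trans (cong (frob k) (-x≡x _)) (trans fx (sym (-x≡x _)))
      ; 0#-closed = frob-0# k
      ; 1#-closed = frob-1# k
      }
    ; inverse   = λ {x} fx x≢0 → let x⁻¹ , xx⁻¹≡1 = inverse x x≢0 in
        x⁻¹ , *-cancelˡ x≢0 (trans (cong (_* frob k x⁻¹) (sym fx))
                (trans (sym (frob-* k x x⁻¹)) (trans (cong (frob k) xx⁻¹≡1)
                (trans (frob-1# k) (sym xx⁻¹≡1))))) , xx⁻¹≡1
    }

  fixedField-order : ∀ k → HasOrder (Subfield.setoid (fixedField k)) (length (fixed k))
  fixedField-order k = record
    { to        = λ (_ , fx) → index (∈-fixed⁺ k fx)
    ; from      = λ i → lookup (fixed k) i , ∈-fixed⁻ k (∈-lookup i)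
    ; to-cong   = λ {(x , fx)} {(y , fy)} x≡y → lookup-injective (fixed-unique k)
        (trans (sym (lookup-index (∈-fixed⁺ k fx))) (trans x≡y (lookup-index (∈-fixed⁺ k fy))))
    ; from-cong = cong (lookup (fixed k))
    ; inverse   = (λ {i} {(y , fy)} y≡ → lookup-injective (fixed-unique k)
                    (trans (sym (lookup-index (∈-fixed⁺ k fy))) y≡))
                , (λ { {(x , fx)} refl → sym (lookup-index (∈-fixed⁺ k fx)) })
    }

-- The forms `F`, `N` and `det`, and the values of `N`

module Multiplication {m s : ℕ} (0<s : 0 < s) (s<m : s < m) (L : GF (2 ℕ.^ m) c)
  (t : Quadruple L s) (legitimate : Legitimate L s t) where

  open FixedField {m = m} L public

  private
    p₁ p₂ p₃ p₄ : Carrier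
    p₁ = proj₁ t
    p₂ = proj₁ (proj₂ t)
    p₃ = proj₁ (proj₂ (proj₂ t))
    p₄ = proj₂ (proj₂ (proj₂ t))

    p₁≢0 : p₁ ≢ 0#
    p₁≢0 = proj₁ legitimate

    σ : Carrier → Carrier
    σ = frob s

    g : ℕ
    g = gcd m s

    0<m : 0 < m
    0<m = ℕ.≤-<-trans z≤n s<m

    g≢0 : g ≢ 0
    g≢0 g≡0 = ℕ.>⇒≢ 0<m (gcd[m,n]≡0⇒m≡0 g≡0)

    0<g : 0 < g
    0<g = ℕ.n≢0⇒n>0 g≢0

    g≤s : g ≤ s
    g≤s = ∣⇒≤ {{ℕ.>-nonZero 0<s}} (gcd[m,n]∣n m s)

    -- As a common divisor of m and s, g divides the positive number m - s.
    g+s≤m : g ℕ.+ s ≤ m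
    g+s≤m = subst (g ℕ.+ s ≤_) (ℕ.m∸n+n≡m (ℕ.<⇒≤ s<m)) (ℕ.+-monoˡ-≤ s
      (∣⇒≤ {{ℕ.>-nonZero (ℕ.m<n⇒0<n∸m s<m)}}
        (∣m+n∣m⇒∣n (subst (g ∣_) (sym (ℕ.m+[n∸m]≡n (ℕ.<⇒≤ s<m))) (gcd[m,n]∣m m s))
                   (gcd[m,n]∣n m s))))

  -- The fixed fields of `frob s` and `frob g` agree: all of L is fixed by `frob m`, so an element
  -- fixed by `frob s` is fixed by `frob g`; conversely g divides s. As g also divides m,
  -- `length-fixed` applies to g.
  fixedField-order-gcd : HasOrder (Subfield.setoid (fixedField s)) (2 ℕ.^ g)
  fixedField-order-gcd = subst (HasOrder _) length-fixed-s (fixedField-order s)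
    where
    length-fixed-s : length (fixed s) ≡ 2 ℕ.^ g
    length-fixed-s = trans
      (ℕ.≤-antisym
        (⊆⇒length≤ _≟_ (fixed-unique s) λ {x} x∈ →
          ∈-fixed⁺ g (Fixed-gcd {m} {s} (frob-m x) (∈-fixed⁻ s x∈)))
        (⊆⇒length≤ _≟_ (fixed-unique g) λ x∈ →
          ∈-fixed⁺ s (Fixed-∣ (gcd[m,n]∣n m s) (∈-fixed⁻ g x∈))))
      (length-fixed 0<m 0<g (gcd[m,n]∣m m s))

  F : Carrier × Carrier → Carrier × Carrier → Carrier
  F (a , b) (c , d) = p₁ * a * σ c + p₂ * b * σ c + p₃ * a * σ d + p₄ * b * σ d

  N : Carrier × Carrier → Carrier
  N x = F x x

  det : Carrier × Carrier → Carrier × Carrier → Carrier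
  det (a , b) (c , d) = a * d + b * c

  infixr 7 _·_
  _·_ : Carrier → Carrier × Carrier → Carrier × Carrier
  k · (a , b) = k * a , k * b

  infixl 6 _⊕_
  _⊕_ : Carrier × Carrier → Carrier × Carrier → Carrier × Carrier
  (a , b) ⊕ (c , d) = a + c , b + d

  F-·ˡ : ∀ k x y → F (k · x) y ≡ k * F x y
  F-·ˡ k (a , b) (c , d) = solve 9
    (λ p₁ p₂ p₃ p₄ k a b c d →
      p₁ :* (k :* a) :* c :+ p₂ :* (k :* b) :* c :+ p₃ :* (k :* a) :* d :+ p₄ :* (k :* b) :* d
      := k :* (p₁ :* a :* c :+ p₂ :* b :* c :+ p₃ :* a :* d :+ p₄ :* b :* d))
    refl p₁ p₂ p₃ p₄ k a b (σ c) (σ d)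

  F-·ʳ : ∀ k x y → F x (k · y) ≡ σ k * F x y
  F-·ʳ k (a , b) (c , d) = trans
    (cong₂ (λ c d → p₁ * a * c + p₂ * b * c + p₃ * a * d + p₄ * b * d) (frob-* s k c) (frob-* s k d))
    (solve 9
    (λ p₁ p₂ p₃ p₄ k a b c d →
      p₁ :* a :* (k :* c) :+ p₂ :* b :* (k :* c) :+ p₃ :* a :* (k :* d) :+ p₄ :* b :* (k :* d)
      := k :* (p₁ :* a :* c :+ p₂ :* b :* c :+ p₃ :* a :* d :+ p₄ :* b :* d))
    refl p₁ p₂ p₃ p₄ (σ k) a b (σ c) (σ d))

  det-·ˡ : ∀ k x y → det (k · x) y ≡ k * det x y
  det-·ˡ k (a , b) (c , d) =
    solve 5 (λ k a b c d → (k :* a) :* d :+ (k :* b) :* c := k :* (a :* d :+ b :* c)) refl k a b c d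

  det-·ʳ : ∀ k x y → det x (k · y) ≡ k * det x y
  det-·ʳ k (a , b) (c , d) =
    solve 5 (λ k a b c d → a :* (k :* d) :+ b :* (k :* c) := k :* (a :* d :+ b :* c)) refl k a b c d

  det-self : ∀ x → det x x ≡ 0#
  det-self (a , b) = solve 2 (λ a b → a :* b :+ b :* a := con false) refl a b

  N[1,0] : N (1# , 0#) ≡ p₁
  N[1,0] = trans
    (cong₂ (λ x y → p₁ * 1# * x + p₂ * 0# * x + p₃ * 1# * y + p₄ * 0# * y) (frob-1# s) (frob-0# s))
    (solve 4 (λ p₁ p₂ p₃ p₄ → p₁ :* con true :* con true :+ p₂ :* con false :* con true
                :+ p₃ :* con true :* con false :+ p₄ :* con false :* con false := p₁)
      refl p₁ p₂ p₃ p₄)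

  N[X,1] : ∀ X → N (X , 1#) ≡ p₁ * (X * σ X) + p₂ * σ X + p₃ * X + p₄
  N[X,1] X = trans
    (cong (λ y → p₁ * X * σ X + p₂ * 1# * σ X + p₃ * X * y + p₄ * 1# * y) (frob-1# s))
    (solve 6 (λ p₁ p₂ p₃ p₄ X Y → p₁ :* X :* Y :+ p₂ :* con true :* Y
                :+ p₃ :* X :* con true :+ p₄ :* con true :* con true
                := p₁ :* (X :* Y) :+ p₂ :* Y :+ p₃ :* X :+ p₄)
      refl p₁ p₂ p₃ p₄ X (σ X))

  N[X,1]≢0 : ∀ X → N (X , 1#) ≢ 0#
  N[X,1]≢0 X NX≡0 = proj₂ legitimate (X , (begin
    p₁ * X ^ (2 ℕ.^ s ℕ.+ 1) + p₂ * σ X + p₃ * X + p₄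
      ≡⟨ cong (λ e → p₁ * X ^ e + p₂ * σ X + p₃ * X + p₄) (ℕ.+-comm (2 ℕ.^ s) 1) ⟩
    p₁ * (X * σ X) + p₂ * σ X + p₃ * X + p₄  ≡⟨ N[X,1] X ⟨
    N (X , 1#)                               ≡⟨ NX≡0 ⟩
    0#                                       ∎))
    where open ≡-Reasoning

  poly-N[X,1] : Poly p₁ (suc (2 ℕ.^ s)) (λ X → N (X , 1#))
  poly-N[X,1] = poly-cong N[X,1]
    (subst (λ a → Poly a (suc (2 ℕ.^ s)) (λ X → p₁ * (X * σ X) + p₂ * σ X + p₃ * X + p₄)) lead
      (poly-+ (poly-+ (poly-+
        (poly-scale p₁ (poly-^ (suc (2 ℕ.^ s))))
        (poly-suc (poly-scale p₂ (poly-^ (2 ℕ.^ s)))))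
        (poly-< (s≤s (ℕ.m^n>0 2 s)) (poly-scale p₃ (poly-cong (sym ∘ *-identityʳ) (poly-^ 1)))))
        (poly-< (s≤s z≤n) (const λ _ → refl))))
    where
    lead : p₁ * 1# + 0# + 0# + 0# ≡ p₁
    lead = solve 1 (λ p₁ → p₁ :* con true :+ con false :+ con false :+ con false := p₁) refl p₁

  -- N(X, 1) / p₁ is a polynomial in X of degree 2^s + 1 without zeros, so if all
  -- its values were in the fixed field, which has 2^g elements, then
  -- 2^m ≤ (2^g − 1)(2^s + 1), against g + s ≤ m.
  ¬N[X,1]/p₁-fixed : ¬ (∀ X → ∃ λ n → Fixed s n × N (X , 1#) ≡ p₁ * n)
  ¬N[X,1]/p₁-fixed ratio = ℕ.<⇒≱ bound
    (subst (_≤ Y ℕ.* suc (2 ℕ.^ s)) length-elements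
      (length≤fibres _≟_ h (suc (2 ℕ.^ s)) ys elements-unique (λ {X} _ → h∈ X) (λ _ → fibre)))
    where
    h : Carrier → Carrier
    h X = proj₁ (ratio X)

    fixed* : ∀ x → Dec (x ≢ 0#)
    fixed* x = ¬? (x ≟ 0#)

    ys : List Carrier
    ys = filter fixed* (fixed g)

    Y : ℕ
    Y = length ys

    h∈ : ∀ X → h X ∈ ys
    h∈ X = let n , σn≡n , NX≡ = ratio X in
      ∈-filter⁺ fixed* (∈-fixed⁺ g (Fixed-gcd {m} {s} (frob-m n) σn≡n))
        λ n≡0 → N[X,1]≢0 X (trans NX≡ (trans (cong (p₁ *_) n≡0) (zeroʳ p₁)))

    fibre : ∀ {y zs} → Unique zs → All (λ z → h z ≡ y) zs → length zs ≤ suc (2 ℕ.^ s)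
    fibre {y} zs! hz≡ = length-roots p₁≢0
      (subst (λ a → Poly a (suc (2 ℕ.^ s)) (λ X → N (X , 1#) + p₁ * y)) (+-identityʳ p₁)
        (poly-+ poly-N[X,1] (poly-< (s≤s z≤n) (const {f = λ _ → p₁ * y} λ _ → refl))))
      zs!
      (All.map (λ {z} hz≡y → x≡y⇒x+y≡0 (trans (proj₂ (proj₂ (ratio z))) (cong (p₁ *_) hz≡y))) hz≡)

    1+Y≤2^g : suc Y ≤ 2 ℕ.^ g
    1+Y≤2^g = ℕ.≤-trans
      (⊆⇒length≤ _≟_ {xs = 0# ∷ ys}
        (All.map (λ y≢0 → y≢0 ∘ sym) (All.all-filter fixed* (fixed g))
          ∷ Unique.filter⁺ fixed* (fixed-unique g))
        λ { (here refl) → ∈-fixed⁺ g (frob-0# g)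
          ; (there y∈)  → proj₁ (∈-filter⁻ fixed* y∈) })
      (length-fixed-≤ 0<g)

    bound : Y ℕ.* suc (2 ℕ.^ s) < 2 ℕ.^ m
    bound = begin-strict
      Y ℕ.* suc (2 ℕ.^ s)         ≡⟨ ℕ.*-suc Y (2 ℕ.^ s) ⟩
      -- The lone `Y` is below 2^g, hence below 2^s because g ≤ s; replacing it by 2^s gives (Y + 1)
      -- 2^s.
      Y ℕ.+ Y ℕ.* 2 ℕ.^ s         <⟨ ℕ.+-monoˡ-< _ (ℕ.≤-trans 1+Y≤2^g (ℕ.^-monoʳ-≤ 2 g≤s)) ⟩
      2 ℕ.^ s ℕ.+ Y ℕ.* 2 ℕ.^ s   ≤⟨ ℕ.*-monoˡ-≤ (2 ℕ.^ s) 1+Y≤2^g ⟩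
      2 ℕ.^ g ℕ.* 2 ℕ.^ s         ≡⟨ ℕ.^-distribˡ-+-* 2 g s ⟨
      2 ℕ.^ (g ℕ.+ s)             ≤⟨ ℕ.^-monoʳ-≤ 2 g+s≤m ⟩
      2 ℕ.^ m                     ∎
      where open ℕ.≤-Reasoning

  -- Additive maps intertwining the multiplication

  -- Both B(2,m,s,l,t) (μ = 1, ν = l) and its opposite (μ = l, ν = 1) have the
  -- multiplication mul below.
  module Classification (μ ν : Carrier) (μ≢0 : μ ≢ 0#) (ν≢0 : ν ≢ 0#)
    (ψ-kernel : ∀ e → μ * σ e ≡ ν * e → e ≡ 0#) where

    mul : Carrier × Carrier → Carrier × Carrier → Carrier × Carrier
    mul x y = μ * F x y + ν * F y x , det x y

    ψ : Carrier → Carrier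
    ψ e = μ * σ e + ν * e

    ψ-+ : ∀ x y → ψ (x + y) ≡ ψ x + ψ y
    ψ-+ x y = trans (cong (λ z → μ * z + ν * (x + y)) (frob-+ s x y))
      (solve 6 (λ μ ν x y x′ y′ → μ :* (x′ :+ y′) :+ ν :* (x :+ y)
          := (μ :* x′ :+ ν :* x) :+ (μ :* y′ :+ ν :* y)) refl μ ν x y (σ x) (σ y))

    -- In characteristic 2 `ψ-kernel` says that the additive map `ψ` has trivial kernel; on a finite
    -- set injectivity suffices.
    ψ-surjective : ∀ z → ∃ λ e → ψ e ≡ z
    ψ-surjective = injective⇒surjective ψ λ {x} {y} eq →
      x+y≡0⇒x≡y (ψ-kernel (x + y) (x+y≡0⇒x≡y (trans (ψ-+ x y) (x≡y⇒x+y≡0 eq))))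

    -- Comparing the coefficients of σ w and of w gives σ c = n = c.
    ψ-semilinear : ∀ {n c} → (∀ w → ψ (c * w) ≡ ψ w * n) → Fixed s n
    ψ-semilinear {n} {c} ψc with c ≟ n
    ... | yes refl = *-cancelˡ μ≢0 (x+y≡0⇒x≡y (begin
      μ * σ c + μ * c
        ≡⟨ solve 4 (λ μ ν c c′ → μ :* c′ :+ μ :* c
             := (μ :* c′ :+ ν :* c) :+ (μ :* con true :+ ν :* con true) :* c) refl μ ν c (σ c) ⟩
      ψ c + (μ * 1# + ν * 1#) * c
        ≡⟨ cong₂ (λ x y → ψ x + (μ * y + ν * 1#) * c) (*-identityʳ c) (frob-1# s) ⟨
      ψ (c * 1#) + ψ 1# * c          ≡⟨ x≡y⇒x+y≡0 (ψc 1#) ⟩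
      0#                             ∎))
      where open ≡-Reasoning
    -- If c and n differ, then w = 1 shows that the coefficients of σ w and w are the same nonzero
    -- `v`. Hence σ w = w for every w, although 0 < s < m.
    ... | no c≢n = contradiction (λ w → *-cancelˡ (*-nonZero ν≢0 (x≢y⇒x+y≢0 c≢n)) (x+y≡0⇒x≡y (all w)))
                     (¬allFixed 0<s s<m)
      where
      open ≡-Reasoning
      v : Carrier
      v = ν * (c + n)

      eqn : ∀ w → μ * (σ c + n) * σ w + v * w ≡ 0#
      eqn w = begin
        μ * (σ c + n) * σ w + v * w
          ≡⟨ solve 7 (λ μ ν c n w c′ w′ → μ :* (c′ :+ n) :* w′ :+ (ν :* (c :+ n)) :* w
               := (μ :* (c′ :* w′) :+ ν :* (c :* w)) :+ (μ :* w′ :+ ν :* w) :* n)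
             refl μ ν c n w (σ c) (σ w) ⟩
        μ * (σ c * σ w) + ν * (c * w) + ψ w * n
          ≡⟨ cong (λ z → μ * z + ν * (c * w) + ψ w * n) (frob-* s c w) ⟨
        ψ (c * w) + ψ w * n  ≡⟨ x≡y⇒x+y≡0 (ψc w) ⟩
        0#                   ∎

      u≡v : μ * (σ c + n) ≡ v
      u≡v = x+y≡0⇒x≡y (trans
        (cong₂ _+_ (trans (sym (*-identityʳ _)) (cong (μ * (σ c + n) *_) (sym (frob-1# s)))) (sym (*-identityʳ v)))
        (eqn 1#))

      all : ∀ w → v * σ w + v * w ≡ 0#
      all w = trans (cong (λ u → u * σ w + v * w) (sym u≡v)) (eqn w)

    -- If the value were nonzero, comparing the points (X,1) and (1,0) would put N(X,1)/p₁ in the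
    -- fixed field for every X. Nothing is assumed of `f` itself, because the lemma serves twice:
    -- for the second component of C(z,0), and for the first component corrected by a multiple of z.
    κ[1,0]≡0 : (f : Carrier → Carrier) (κ : Carrier × Carrier → Carrier) →
      (∀ x e → f (ψ e * N x) ≡ κ x * e) → κ (1# , 0#) ≡ 0#
    κ[1,0]≡0 f κ f≡ with κ (1# , 0#) ≟ 0#
    ... | yes κ₀≡0 = κ₀≡0
    ... | no  κ₀≢0 = contradiction ratio ¬N[X,1]/p₁-fixed
      where
      κ₀ κ₀⁻¹ p₁⁻¹ : Carrier
      κ₀   = κ (1# , 0#)
      κ₀⁻¹ = proj₁ (inverse κ₀ κ₀≢0)
      p₁⁻¹ = proj₁ (inverse p₁ p₁≢0)

      p₁p₁⁻¹ : ∀ x → p₁ * (p₁⁻¹ * x) ≡ x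
      p₁p₁⁻¹ x = trans (sym (*-assoc _ _ _)) (trans (cong (_* x) (proj₂ (inverse p₁ p₁≢0))) (*-identityˡ x))

      ratio : ∀ X → ∃ λ n → Fixed s n × N (X , 1#) ≡ p₁ * n
      ratio X = n , ψ-semilinear {n} {κ (X , 1#) * κ₀⁻¹} semilinear , sym (p₁p₁⁻¹ _)
        where
        open ≡-Reasoning
        n : Carrier
        n = p₁⁻¹ * N (X , 1#)

        semilinear : ∀ w → ψ (κ (X , 1#) * κ₀⁻¹ * w) ≡ ψ w * n
        -- Here `e` makes ψ(w) N(X,1) equal to ψ(e) N(1,0). Computing `f` there in both ways gives
        -- κ(X,1) w = κ₀ e, so `e` is a constant multiple of `w`.
        semilinear w = let e , ψe≡ = ψ-surjective (ψ w * n) in trans (cong ψ (*-cancelˡ κ₀≢0 (begin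
          κ₀ * (κ (X , 1#) * κ₀⁻¹ * w)
            ≡⟨ solve 4 (λ x y z w → x :* (y :* z :* w) := (x :* z) :* (y :* w)) refl
                 κ₀ (κ (X , 1#)) κ₀⁻¹ w ⟩
          κ₀ * κ₀⁻¹ * (κ (X , 1#) * w)
            ≡⟨ trans (cong (_* (κ (X , 1#) * w)) (proj₂ (inverse κ₀ κ₀≢0))) (*-identityˡ _) ⟩
          κ (X , 1#) * w                      ≡⟨ f≡ (X , 1#) w ⟨
          f (ψ w * N (X , 1#))                ≡⟨ cong (λ z → f (ψ w * z)) (p₁p₁⁻¹ _) ⟨
          f (ψ w * (p₁ * n))
            ≡⟨ cong f (solve 3 (λ x y z → x :* (y :* z) := (x :* z) :* y) refl (ψ w) p₁ n) ⟩
          f (ψ w * n * p₁)                    ≡⟨ cong₂ (λ x y → f (x * y)) ψe≡ N[1,0] ⟨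
          f (ψ e * N (1# , 0#))               ≡⟨ f≡ (1# , 0#) e ⟩
          κ₀ * e                              ∎))) ψe≡

    mul-·ˡ : ∀ {k} → Fixed s k → ∀ x y → mul (k · x) y ≡ k · mul x y
    mul-·ˡ {k} σk≡k x y = cong₂ _,_
      (trans (cong₂ (λ u v → μ * u + ν * v) (F-·ˡ k x y) (trans (F-·ʳ k y x) (cong (_* F y x) σk≡k)))
        (solve 5 (λ μ ν k u v → μ :* (k :* u) :+ ν :* (k :* v) := k :* (μ :* u :+ ν :* v)) refl
          μ ν k (F x y) (F y x)))
      (det-·ˡ k x y)

    scalar : (A C : Carrier × Carrier → Carrier × Carrier) → (∀ x y → C (x ⊕ y) ≡ C x ⊕ C y) →
      (∀ x y → mul (A x) y ≡ C (mul x y)) → ∃ λ α → Fixed s α × (∀ x → A x ≡ α · x)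
    scalar A C C-⊕ AC = α , σα≡α , A≡α
      where
      open ≡-Reasoning
      α : Carrier
      α = proj₁ (A (1# , 0#))

      mul-self : ∀ x e → mul x (e · x) ≡ (ψ e * N x , 0#)
      mul-self x e = cong₂ _,_
        (trans (cong₂ (λ u v → μ * u + ν * v) (F-·ʳ e x x) (F-·ˡ e x x))
          (solve 5 (λ μ ν e e′ n → μ :* (e′ :* n) :+ ν :* (e :* n) := (μ :* e′ :+ ν :* e) :* n)
            refl μ ν e (σ e) (N x)))
        (trans (det-·ʳ e x x) (trans (cong (e *_) (det-self x)) (zeroʳ e)))

      C[z,0] : ∀ x e → C (ψ e * N x , 0#) ≡ mul (A x) (e · x)
      C[z,0] x e = trans (cong C (sym (mul-self x e))) (sym (AC x (e · x)))

      γ δ : Carrier → Carrier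
      γ z = proj₂ (C (z , 0#))
      δ z = proj₂ (C (0# , z))

      γ≡ : ∀ x e → γ (ψ e * N x) ≡ det (A x) x * e
      γ≡ x e = trans (cong proj₂ (C[z,0] x e)) (trans (det-·ʳ e (A x) x) (*-comm e _))

      -- Every z has the form ψ(e) N(1,0), since N(1,0) = p₁ is nonzero and ψ is onto; so it is
      -- enough that det(A(x),x) vanishes at x = (1,0).
      γ≡0 : ∀ z → γ z ≡ 0#
      γ≡0 z = let p₁⁻¹ , p₁p₁⁻¹≡1 = inverse p₁ p₁≢0
                  e , ψe≡ = ψ-surjective (z * p₁⁻¹) in begin
        γ z
          ≡⟨ cong γ (trans (*-assoc z p₁⁻¹ p₁)
               (trans (cong (z *_) (trans (*-comm _ _) p₁p₁⁻¹≡1)) (*-identityʳ z))) ⟨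
        γ (z * p₁⁻¹ * p₁)             ≡⟨ cong₂ (λ x y → γ (x * y)) ψe≡ N[1,0] ⟨
        γ (ψ e * N (1# , 0#))         ≡⟨ γ≡ (1# , 0#) e ⟩
        det (A (1# , 0#)) (1# , 0#) * e
          ≡⟨ cong (_* e) (κ[1,0]≡0 γ (λ x → det (A x) x) γ≡) ⟩
        0# * e                        ≡⟨ zeroˡ e ⟩
        0#                            ∎

      det≡δ : ∀ x y → det (A x) y ≡ δ (det x y)
      det≡δ x y = begin
        det (A x) y                                ≡⟨ cong proj₂ (AC x y) ⟩
        proj₂ (C (mul x y))
          ≡⟨ cong₂ (λ u v → proj₂ (C (u , v))) (+-identityʳ _) (+-identityˡ _) ⟨
        proj₂ (C ((proj₁ (mul x y) , 0#) ⊕ (0# , det x y)))  ≡⟨ cong proj₂ (C-⊕ _ _) ⟩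
        γ (proj₁ (mul x y)) + δ (det x y)          ≡⟨ cong (_+ δ (det x y)) (γ≡0 _) ⟩
        0# + δ (det x y)                           ≡⟨ +-identityˡ _ ⟩
        δ (det x y)                                ∎

      -- Any value d of `det` is also attained at the pair (1,0), (0,d), where det(A(1,0),(0,d)) = α
      -- d. This identifies `δ` on all values of `det`.
      det≡α : ∀ x y → det (A x) y ≡ α * det x y
      det≡α x y = begin
        det (A x) y                        ≡⟨ det≡δ x y ⟩
        δ (det x y)
          ≡⟨ cong δ (solve 1 (λ d → con true :* d :+ con false :* con false := d) refl (det x y)) ⟨
        δ (det (1# , 0#) (0# , det x y))   ≡⟨ det≡δ (1# , 0#) (0# , det x y) ⟨
        α * det x y + proj₂ (A (1# , 0#)) * 0#
          ≡⟨ trans (cong (α * det x y +_) (zeroʳ _)) (+-identityʳ _) ⟩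
        α * det x y                        ∎

      -- Nondegeneracy of `det`: pairing with the two basis vectors recovers the coordinates.
      A≡α : ∀ x → A x ≡ α · x
      A≡α x@(a , b) = cong₂ _,_
        (trans (coord₁ (A x)) (trans (det≡α x (0# , 1#)) (cong (α *_) (sym (coord₁ x)))))
        (trans (coord₂ (A x)) (trans (det≡α x (1# , 0#)) (cong (α *_) (sym (coord₂ x)))))
        where
        coord₁ : ∀ z → proj₁ z ≡ det z (0# , 1#)
        coord₁ (a , b) = solve 2 (λ a b → a := a :* con true :+ b :* con false) refl a b
        coord₂ : ∀ z → proj₂ z ≡ det z (1# , 0#)
        coord₂ (a , b) = solve 2 (λ a b → b := a :* con false :+ b :* con true) refl a b

      -- The deviation of C from multiplication by α on first components. The terms with σ e cancel,
      -- leaving a multiple of e as `κ[1,0]≡0` requires.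
      f : Carrier → Carrier
      f z = proj₁ (C (z , 0#)) + α * z

      f≡ : ∀ x e → f (ψ e * N x) ≡ ν * (σ α + α) * N x * e
      f≡ x e = begin
        proj₁ (C (ψ e * N x , 0#)) + α * (ψ e * N x)
          ≡⟨ cong (λ z → proj₁ z + α * (ψ e * N x))
               (trans (C[z,0] x e) (cong (λ z → mul z (e · x)) (A≡α x))) ⟩
        μ * F (α · x) (e · x) + ν * F (e · x) (α · x) + α * (ψ e * N x)
          ≡⟨ cong₂ (λ u v → μ * u + ν * v + α * (ψ e * N x))
               (trans (F-·ˡ α x (e · x)) (cong (α *_) (F-·ʳ e x x)))
               (trans (F-·ˡ e x (α · x)) (cong (e *_) (F-·ʳ α x x))) ⟩
        μ * (α * (σ e * N x)) + ν * (e * (σ α * N x)) + α * (ψ e * N x)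
          ≡⟨ solve 7 (λ μ ν a a′ e e′ n →
               μ :* (a :* (e′ :* n)) :+ ν :* (e :* (a′ :* n)) :+ a :* ((μ :* e′ :+ ν :* e) :* n)
               := ν :* (a′ :+ a) :* n :* e) refl μ ν α (σ α) e (σ e) (N x) ⟩
        ν * (σ α + α) * N x * e  ∎

      σα≡α : σ α ≡ α
      σα≡α with σ α ≟ α
      ... | yes eq = eq
      ... | no neq = contradiction
        (trans (cong (ν * (σ α + α) *_) (sym N[1,0])) (κ[1,0]≡0 f (λ x → ν * (σ α + α) * N x) f≡))
        (*-nonZero (*-nonZero ν≢0 (x≢y⇒x+y≢0 neq)) p₁≢0)


-- Nuclei and center of the isotope S

module Isotope {m s : ℕ} (0<s : 0 < s) (s<m : s < m) (L : GF (2 ℕ.^ m) c)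
  (t : Quadruple L s) (legitimate : Legitimate L s t)
  (l : GF.Carrier L) (l≢0 : l ≢ GF.0# L) (l∉ : ¬ [L*]^[σ-1] L s l)
  (S : Semifield b) (isotopic : Isotopic (Semifield.rawRingWithoutOne S) (B L s l t)) where

  private
    module S = Semifield S
    open Multiplication 0<s s<m L t legitimate

    -- A nonzero solution e would give l = e^(σ-1), which is excluded.
    1*σe≡l*e⇒e≡0 : ∀ e → 1# * frob s e ≡ l * e → e ≡ 0#
    1*σe≡l*e⇒e≡0 e eq with e ≟ 0#
    ... | yes e≡0 = e≡0
    ... | no  e≢0 = contradiction (e , e≢0 , *-cancelˡ e≢0 (begin
      e * l                      ≡⟨ *-comm e l ⟩
      l * e                      ≡⟨ eq ⟨
      1# * frob s e              ≡⟨ *-identityˡ _ ⟩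
      e ^ (2 ℕ.^ s)              ≡⟨ cong (e ^_) (ℕ.m+[n∸m]≡n (ℕ.m^n>0 2 s)) ⟨
      e * e ^ (2 ℕ.^ s ℕ.∸ 1)    ∎)) l∉
      where open ≡-Reasoning

    -- Inversion carries a nonzero solution to one of σ e = l e, reducing the opposite
    -- multiplication to the previous case.
    l*σe≡1*e⇒e≡0 : ∀ e → l * frob s e ≡ 1# * e → e ≡ 0#
    l*σe≡1*e⇒e≡0 e eq with e ≟ 0#
    ... | yes e≡0 = e≡0
    ... | no  e≢0 = contradiction (1*σe≡l*e⇒e≡0 e⁻¹ (begin
      1# * frob s e⁻¹                     ≡⟨ cong (_* frob s e⁻¹) ee⁻¹≡1 ⟨
      e * e⁻¹ * frob s e⁻¹                ≡⟨ cong (λ x → x * e⁻¹ * frob s e⁻¹) (trans eq (*-identityˡ e)) ⟨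
      l * frob s e * e⁻¹ * frob s e⁻¹
        ≡⟨ solve 4 (λ x y z w → x :* y :* z :* w := x :* z :* (y :* w)) refl
             l (frob s e) e⁻¹ (frob s e⁻¹) ⟩
      l * e⁻¹ * (frob s e * frob s e⁻¹)   ≡⟨ cong (l * e⁻¹ *_) (frob-* s e e⁻¹) ⟨
      l * e⁻¹ * frob s (e * e⁻¹)          ≡⟨ cong (l * e⁻¹ *_) (trans (cong (frob s) ee⁻¹≡1) (frob-1# s)) ⟩
      l * e⁻¹ * 1#                        ≡⟨ *-identityʳ _ ⟩
      l * e⁻¹                             ∎))
      λ e⁻¹≡0 → 1≢0 (trans (sym ee⁻¹≡1) (trans (cong (e *_) e⁻¹≡0) (zeroʳ e)))
      where
      open ≡-Reasoning
      e⁻¹ : Carrier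
      e⁻¹ = proj₁ (inverse e e≢0)
      ee⁻¹≡1 : e * e⁻¹ ≡ 1#
      ee⁻¹≡1 = proj₂ (inverse e e≢0)

    module B₁ = Classification 1# l 1≢0 l≢0 1*σe≡l*e⇒e≡0
    module Bᵒᵖ = Classification l 1# l≢0 1≢0 l*σe≡1*e⇒e≡0

    infixl 7 _∘B_
    _∘B_ : Carrier × Carrier → Carrier × Carrier → Carrier × Carrier
    _∘B_ = RawRingWithoutOne._*_ (B L s l t)

    ∘B≡mul : ∀ x y → x ∘B y ≡ B₁.mul x y
    ∘B≡mul (a , b) (c , d) = let p₁ , p₂ , p₃ , p₄ = t in cong (_, a * d + b * c) (solve 13
      (λ p₁ p₂ p₃ p₄ l a b c d a′ b′ c′ d′ →
        p₁ :* a :* c′ :+ l :* p₁ :* a′ :* c :+ p₂ :* b :* c′ :+ l :* p₂ :* a′ :* d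
        :+ p₃ :* a :* d′ :+ l :* p₃ :* b′ :* c :+ p₄ :* b :* d′ :+ l :* p₄ :* b′ :* d
        := con true :* (p₁ :* a :* c′ :+ p₂ :* b :* c′ :+ p₃ :* a :* d′ :+ p₄ :* b :* d′)
           :+ l :* (p₁ :* c :* a′ :+ p₂ :* d :* a′ :+ p₃ :* c :* b′ :+ p₄ :* d :* b′))
      refl p₁ p₂ p₃ p₄ l a b c d (frob s a) (frob s b) (frob s c) (frob s d))

    ∘B≡mulᵒᵖ : ∀ x y → x ∘B y ≡ Bᵒᵖ.mul y x
    ∘B≡mulᵒᵖ x@(a , b) y@(c , d) = trans (∘B≡mul x y) (cong₂ _,_ (+-comm _ _)
      (solve 4 (λ a b c d → a :* d :+ b :* c := c :* b :+ d :* a) refl a b c d))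

    open Isotopic isotopic
    module α₁ = GroupMorphisms.IsGroupIsomorphism α₁-additive
    module α₂ = GroupMorphisms.IsGroupIsomorphism α₂-additive
    module β  = GroupMorphisms.IsGroupIsomorphism β-additive

    α₁⁻¹ α₂⁻¹ : S.Carrier → Carrier × Carrier
    α₁⁻¹ p = proj₁ (α₁.surjective p)
    α₂⁻¹ p = proj₁ (α₂.surjective p)

    β⁻¹ : Carrier × Carrier → S.Carrier
    β⁻¹ x = proj₁ (β.surjective x)

    αα₁⁻¹ : ∀ p → α₁ (α₁⁻¹ p) ≡ p
    αα₁⁻¹ p = proj₂ (α₁.surjective p) refl

    αα₂⁻¹ : ∀ p → α₂ (α₂⁻¹ p) ≡ p
    αα₂⁻¹ p = proj₂ (α₂.surjective p) refl

    ββ⁻¹ : ∀ x → β (β⁻¹ x) ≡ x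
    ββ⁻¹ x = proj₂ (β.surjective x) refl

    β⁻¹β : ∀ p → β⁻¹ (β p) ≡ p
    β⁻¹β p = β.injective (ββ⁻¹ (β p))

    β⁻¹-⊕ : ∀ x y → β⁻¹ (x ⊕ y) ≡ β⁻¹ x S.+ β⁻¹ y
    β⁻¹-⊕ x y = β.injective (trans (ββ⁻¹ _)
      (sym (trans (β.∙-homo _ _) (cong₂ _⊕_ (ββ⁻¹ x) (ββ⁻¹ y)))))

    S-idˡ : ∀ p → S.1# S.* p ≡ p
    S-idˡ = proj₁ S.*-identity

    S-idʳ : ∀ p → p S.* S.1# ≡ p
    S-idʳ = proj₂ S.*-identity

    -- For k in the fixed field the three actions coincide.
    act₁ act₂ act : Carrier → S.Carrier → S.Carrier
    act₁ k p = α₁ (k · α₁⁻¹ p)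
    act₂ k p = α₂ (k · α₂⁻¹ p)
    act  k p = β⁻¹ (k · β p)

    act₁-* : ∀ {k} → Fixed s k → ∀ p q → act₁ k p S.* q ≡ act k (p S.* q)
    act₁-* {k} σk≡k p q = β.injective (begin
      β (α₁ (k · α₁⁻¹ p) S.* q)                ≡⟨ cong (λ q → β (α₁ (k · α₁⁻¹ p) S.* q)) (αα₂⁻¹ q) ⟨
      β (α₁ (k · α₁⁻¹ p) S.* α₂ (α₂⁻¹ q))      ≡⟨ isotopy _ _ ⟩
      (k · α₁⁻¹ p) ∘B α₂⁻¹ q                   ≡⟨ ∘B≡mul _ _ ⟩
      B₁.mul (k · α₁⁻¹ p) (α₂⁻¹ q)             ≡⟨ B₁.mul-·ˡ σk≡k _ _ ⟩
      k · B₁.mul (α₁⁻¹ p) (α₂⁻¹ q)             ≡⟨ cong (k ·_) (∘B≡mul _ _) ⟨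
      k · (α₁⁻¹ p ∘B α₂⁻¹ q)                   ≡⟨ cong (k ·_) (isotopy _ _) ⟨
      k · β (α₁ (α₁⁻¹ p) S.* α₂ (α₂⁻¹ q))      ≡⟨ cong₂ (λ p q → k · β (p S.* q)) (αα₁⁻¹ p) (αα₂⁻¹ q) ⟩
      k · β (p S.* q)                          ≡⟨ ββ⁻¹ _ ⟨
      β (act k (p S.* q))                      ∎)
      where open ≡-Reasoning

    *-act₂ : ∀ {k} → Fixed s k → ∀ p q → p S.* act₂ k q ≡ act k (p S.* q)
    *-act₂ {k} σk≡k p q = β.injective (begin
      β (p S.* α₂ (k · α₂⁻¹ q))                ≡⟨ cong (λ p → β (p S.* α₂ (k · α₂⁻¹ q))) (αα₁⁻¹ p) ⟨
      β (α₁ (α₁⁻¹ p) S.* α₂ (k · α₂⁻¹ q))      ≡⟨ isotopy _ _ ⟩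
      α₁⁻¹ p ∘B (k · α₂⁻¹ q)                   ≡⟨ ∘B≡mulᵒᵖ _ _ ⟩
      Bᵒᵖ.mul (k · α₂⁻¹ q) (α₁⁻¹ p)            ≡⟨ Bᵒᵖ.mul-·ˡ σk≡k _ _ ⟩
      k · Bᵒᵖ.mul (α₂⁻¹ q) (α₁⁻¹ p)            ≡⟨ cong (k ·_) (∘B≡mulᵒᵖ _ _) ⟨
      k · (α₁⁻¹ p ∘B α₂⁻¹ q)                   ≡⟨ cong (k ·_) (isotopy _ _) ⟨
      k · β (α₁ (α₁⁻¹ p) S.* α₂ (α₂⁻¹ q))      ≡⟨ cong₂ (λ p q → k · β (p S.* q)) (αα₁⁻¹ p) (αα₂⁻¹ q) ⟩
      k · β (p S.* q)                          ≡⟨ ββ⁻¹ _ ⟨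
      β (act k (p S.* q))                      ∎)
      where open ≡-Reasoning

    -- The identity of S links the actions: put q = 1 in `act₁-*`.
    act₁≡act : ∀ {k} → Fixed s k → ∀ p → act₁ k p ≡ act k p
    act₁≡act {k} σk≡k p = trans (sym (S-idʳ _)) (trans (act₁-* σk≡k p S.1#) (cong (act k) (S-idʳ p)))

    act₂≡act : ∀ {k} → Fixed s k → ∀ p → act₂ k p ≡ act k p
    act₂≡act {k} σk≡k p = trans (sym (S-idˡ _)) (trans (*-act₂ σk≡k S.1# p) (cong (act k) (S-idˡ p)))

    act-* : ∀ {k} → Fixed s k → ∀ p q → act k p S.* q ≡ act k (p S.* q)
    act-* σk≡k p q = trans (cong (S._* q) (sym (act₁≡act σk≡k p))) (act₁-* σk≡k p q)

    *-act : ∀ {k} → Fixed s k → ∀ p q → p S.* act k q ≡ act k (p S.* q)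
    *-act σk≡k p q = trans (cong (p S.*_) (sym (act₂≡act σk≡k q))) (*-act₂ σk≡k p q)

    scalar : Carrier → S.Carrier
    scalar k = act k S.1#

    IsScalar : Pred S.Carrier _
    IsScalar u = ∃ λ k → Fixed s k × u ≡ scalar k

    scalar-* : ∀ {k} → Fixed s k → ∀ p → scalar k S.* p ≡ act k p
    scalar-* {k} σk≡k p = trans (act-* σk≡k S.1# p) (cong (act k) (S-idˡ p))

    *-scalar : ∀ {k} → Fixed s k → ∀ p → p S.* scalar k ≡ act k p
    *-scalar {k} σk≡k p = trans (*-act σk≡k p S.1#) (cong (act k) (S-idʳ p))

    scalar-central : ∀ {k} → Fixed s k → Center S (scalar k)
    scalar-central {k} σk≡k =
        (λ y w → trans (scalar-* σk≡k _) (sym (trans (cong (S._* w) (scalar-* σk≡k y)) (act-* σk≡k y w))))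
      , (λ y w → trans (cong (y S.*_) (scalar-* σk≡k w)) (trans (*-act σk≡k y w)
                   (sym (trans (cong (S._* w) (*-scalar σk≡k y)) (act-* σk≡k y w)))))
      , (λ y w → trans (cong (y S.*_) (*-scalar σk≡k w)) (trans (*-act σk≡k y w) (sym (*-scalar σk≡k _))))
      , (λ y → trans (scalar-* σk≡k y) (sym (*-scalar σk≡k y)))

    -- Left multiplication by u, transported along α₁ to A and along β to C, satisfies A(x) ∘ y =
    -- C(x ∘ y) by the nucleus condition. Once A is known to be a scalar k, its value at the
    -- preimage of 1 recovers u = u * 1.
    leftNucleus⇒scalar : ∀ {u} → LeftNucleus S u → IsScalar u
    leftNucleus⇒scalar {u} Nu = let k , σk≡k , A≡ = B₁.scalar A C C-⊕ AC in k , σk≡k , (begin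
      u                                   ≡⟨ S-idʳ u ⟨
      u S.* S.1#                          ≡⟨ cong (u S.*_) (αα₁⁻¹ _) ⟨
      u S.* α₁ (α₁⁻¹ S.1#)                ≡⟨ αα₁⁻¹ _ ⟨
      α₁ (α₁⁻¹ (u S.* α₁ (α₁⁻¹ S.1#)))    ≡⟨ cong α₁ (A≡ _) ⟩
      act₁ k S.1#                         ≡⟨ act₁≡act σk≡k _ ⟩
      scalar k                            ∎)
      where
      open ≡-Reasoning
      A C : Carrier × Carrier → Carrier × Carrier
      A x = α₁⁻¹ (u S.* α₁ x)
      C z = β (u S.* β⁻¹ z)

      C-⊕ : ∀ x y → C (x ⊕ y) ≡ C x ⊕ C y
      C-⊕ x y = trans (cong (λ z → β (u S.* z)) (β⁻¹-⊕ x y))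
        (trans (cong β (proj₁ S.distrib _ _ _)) (β.∙-homo _ _))

      AC : ∀ x y → B₁.mul (A x) y ≡ C (B₁.mul x y)
      AC x y = begin
        B₁.mul (A x) y                    ≡⟨ trans (isotopy _ _) (∘B≡mul _ _) ⟨
        β (α₁ (A x) S.* α₂ y)             ≡⟨ cong (λ p → β (p S.* α₂ y)) (αα₁⁻¹ _) ⟩
        β (u S.* α₁ x S.* α₂ y)           ≡⟨ cong β (Nu _ _) ⟨
        β (u S.* (α₁ x S.* α₂ y))         ≡⟨ cong (λ p → β (u S.* p)) (β⁻¹β _) ⟨
        C (β (α₁ x S.* α₂ y))             ≡⟨ cong C (trans (isotopy _ _) (∘B≡mul _ _)) ⟩
        C (B₁.mul x y)                    ∎

    -- The mirror image: right multiplication by u is transported along α₂, and x ∘ y is read as the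
    -- opposite product of y and x.
    rightNucleus⇒scalar : ∀ {u} → RightNucleus S u → IsScalar u
    rightNucleus⇒scalar {u} Nu = let k , σk≡k , A≡ = Bᵒᵖ.scalar A C C-⊕ AC in k , σk≡k , (begin
      u                                   ≡⟨ S-idˡ u ⟨
      S.1# S.* u                          ≡⟨ cong (S._* u) (αα₂⁻¹ _) ⟨
      α₂ (α₂⁻¹ S.1#) S.* u                ≡⟨ αα₂⁻¹ _ ⟨
      α₂ (α₂⁻¹ (α₂ (α₂⁻¹ S.1#) S.* u))    ≡⟨ cong α₂ (A≡ _) ⟩
      act₂ k S.1#                         ≡⟨ act₂≡act σk≡k _ ⟩
      scalar k                            ∎)
      where
      open ≡-Reasoning
      A C : Carrier × Carrier → Carrier × Carrier
      A x = α₂⁻¹ (α₂ x S.* u)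
      C z = β (β⁻¹ z S.* u)

      C-⊕ : ∀ x y → C (x ⊕ y) ≡ C x ⊕ C y
      C-⊕ x y = trans (cong (λ z → β (z S.* u)) (β⁻¹-⊕ x y))
        (trans (cong β (proj₂ S.distrib _ _ _)) (β.∙-homo _ _))

      AC : ∀ x y → Bᵒᵖ.mul (A x) y ≡ C (Bᵒᵖ.mul x y)
      AC x y = begin
        Bᵒᵖ.mul (A x) y                   ≡⟨ trans (isotopy _ _) (∘B≡mulᵒᵖ _ _) ⟨
        β (α₁ y S.* α₂ (A x))             ≡⟨ cong (λ p → β (α₁ y S.* p)) (αα₂⁻¹ _) ⟩
        β (α₁ y S.* (α₂ x S.* u))         ≡⟨ cong β (Nu _ _) ⟩
        β (α₁ y S.* α₂ x S.* u)           ≡⟨ cong (λ p → β (p S.* u)) (β⁻¹β _) ⟨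
        C (β (α₁ y S.* α₂ x))             ≡⟨ cong C (trans (isotopy _ _) (∘B≡mulᵒᵖ _ _)) ⟩
        C (Bᵒᵖ.mul x y)                   ∎

    -- For u = `scalar k`, multiplication by u becomes z ↦ k · z under β, and (1,0) exposes k.
    -- Reading k off the product, not off a proof of `IsScalar u`, makes the map depend on u alone
    -- and additive on all of S.
    eigenvalue : S.Carrier → Carrier
    eigenvalue u = proj₁ (β (u S.* β⁻¹ (1# , 0#)))

    eigenvalue-scalar : ∀ {k} → Fixed s k → eigenvalue (scalar k) ≡ k
    eigenvalue-scalar {k} σk≡k = begin
      proj₁ (β (scalar k S.* β⁻¹ (1# , 0#)))   ≡⟨ cong (proj₁ ∘ β) (scalar-* σk≡k _) ⟩
      proj₁ (β (β⁻¹ (k · β (β⁻¹ (1# , 0#)))))  ≡⟨ cong proj₁ (ββ⁻¹ _) ⟩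
      k * proj₁ (β (β⁻¹ (1# , 0#)))            ≡⟨ cong (λ x → k * proj₁ x) (ββ⁻¹ _) ⟩
      k * 1#                                   ≡⟨ *-identityʳ k ⟩
      k                                        ∎
      where open ≡-Reasoning

    eigenvalue-+ : ∀ u v → eigenvalue (u S.+ v) ≡ eigenvalue u + eigenvalue v
    eigenvalue-+ u v = cong proj₁ (trans (cong β (proj₂ S.distrib _ u v)) (β.∙-homo _ _))

    eigenvalue-* : ∀ {u v} → IsScalar u → IsScalar v → eigenvalue (u S.* v) ≡ eigenvalue u * eigenvalue v
    eigenvalue-* (k , σk≡k , refl) (k′ , σk′≡k′ , refl) = begin
      eigenvalue (scalar k S.* scalar k′)            ≡⟨ cong eigenvalue (scalar-* σk≡k _) ⟩
      eigenvalue (β⁻¹ (k · β (β⁻¹ (k′ · β S.1#))))   ≡⟨ cong (λ x → eigenvalue (β⁻¹ (k · x))) (ββ⁻¹ _) ⟩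
      eigenvalue (β⁻¹ (k · k′ · β S.1#))
        ≡⟨ cong (eigenvalue ∘ β⁻¹) (cong₂ _,_ (*-assoc _ _ _) (*-assoc _ _ _)) ⟨
      eigenvalue (scalar (k * k′))
        ≡⟨ eigenvalue-scalar (trans (frob-* s k k′) (cong₂ _*_ σk≡k σk′≡k′)) ⟩
      k * k′
        ≡⟨ cong₂ _*_ (eigenvalue-scalar σk≡k) (eigenvalue-scalar σk′≡k′) ⟨
      eigenvalue (scalar k) * eigenvalue (scalar k′) ∎
      where open ≡-Reasoning

    S-x≡x : ∀ u → S.- u ≡ u
    S-x≡x u = β.injective (trans (β.⁻¹-homo u) (cong₂ _,_ (-x≡x _) (-x≡x _)))

    eigenvalue-0# : eigenvalue S.0# ≡ 0#
    eigenvalue-0# = begin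
      eigenvalue S.0#
        ≡⟨ cong eigenvalue (IsAbelianGroup.identityˡ S.+-isAbelianGroup S.0#) ⟨
      eigenvalue (S.0# S.+ S.0#)         ≡⟨ eigenvalue-+ S.0# S.0# ⟩
      eigenvalue S.0# + eigenvalue S.0#  ≡⟨ x+x≡0 _ ⟩
      0#                                 ∎
      where open ≡-Reasoning

    -- The center and both nuclei consist exactly of the scalars, so one construction covers all
    -- three; `scalar` is the inverse of `eigenvalue` on them.
    subring≅fixedField : ∀ {P : Pred S.Carrier b} (isSubring : IsSubring S.rawRing P) →
      (∀ {u} → P u → IsScalar u) → (∀ {k} → Fixed s k → P (scalar k)) →
      IsSubring.rawRing isSubring ≅ Subfield.rawRing (fixedField s)
    subring≅fixedField isSubring P⇒scalar scalar⇒P =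
      (λ (u , Pu) → eigenvalue u , fixed-eigenvalue (P⇒scalar Pu)) , record
      { isRingMonomorphism = record
        { isRingHomomorphism = record
          { isSemiringHomomorphism = record
            { isNearSemiringHomomorphism = record
              { +-isMonoidHomomorphism = record
                { isMagmaHomomorphism = record
                  { isRelHomomorphism = record { cong = cong eigenvalue }
                  ; homo = λ (u , _) (v , _) → eigenvalue-+ u v
                  }
                ; ε-homo = eigenvalue-0#
                }
              ; *-homo = λ (_ , Pu) (_ , Pv) → eigenvalue-* (P⇒scalar Pu) (P⇒scalar Pv)
              }
            ; 1#-homo = cong proj₁ (trans (cong β (S-idˡ _)) (ββ⁻¹ _))
            }
          ; -‿homo = λ (u , _) → trans (cong eigenvalue (S-x≡x u)) (sym (-x≡x _))
          }
        ; injective = λ {(_ , Pu)} {(_ , Pv)} → injective (P⇒scalar Pu) (P⇒scalar Pv)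
        }
      ; surjective = λ (k , σk≡k) → (scalar k , scalar⇒P σk≡k) ,
          λ { refl → eigenvalue-scalar σk≡k }
      }
      where
      fixed-eigenvalue : ∀ {u} → IsScalar u → Fixed s (eigenvalue u)
      fixed-eigenvalue (k , σk≡k , refl) = subst (Fixed s) (sym (eigenvalue-scalar σk≡k)) σk≡k

      injective : ∀ {u v} → IsScalar u → IsScalar v → eigenvalue u ≡ eigenvalue v → u ≡ v
      injective (k , σk≡k , refl) (k′ , σk′≡k′ , refl) eq =
        cong scalar (trans (sym (eigenvalue-scalar σk≡k)) (trans eq (eigenvalue-scalar σk′≡k′)))

    scalar⇒center : ∀ {u} → IsScalar u → Center S u
    scalar⇒center (_ , σk≡k , refl) = scalar-central σk≡k

  -- A cycle of inclusions: the center lies in the left nucleus, whose elements are scalars, and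
  -- scalars are central.
  center≐leftNucleus : Center S ≐ LeftNucleus S
  center≐leftNucleus = proj₁ , scalar⇒center ∘ leftNucleus⇒scalar

  center≐rightNucleus : Center S ≐ RightNucleus S
  center≐rightNucleus = proj₁ ∘ proj₂ ∘ proj₂ , scalar⇒center ∘ rightNucleus⇒scalar

  center≅fixedField : center S ≅ Subfield.rawRing (fixedField s)
  center≅fixedField = subring≅fixedField (center-isSubring S) (leftNucleus⇒scalar ∘ proj₁) scalar-central

  leftNucleus≅fixedField : leftNucleus S ≅ Subfield.rawRing (fixedField s)
  leftNucleus≅fixedField =
    subring≅fixedField (leftNucleus-isSubring S) leftNucleus⇒scalar (proj₁ ∘ scalar-central)

  rightNucleus≅fixedField : rightNucleus S ≅ Subfield.rawRing (fixedField s)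
  rightNucleus≅fixedField =
    subring≅fixedField (rightNucleus-isSubring S) rightNucleus⇒scalar
      (proj₁ ∘ proj₂ ∘ proj₂ ∘ scalar-central)

open import Data.Nat.Base using (_^_)

theorem8 : {a b : Level} (m s : ℕ) → 0 < s → s < m →
    (L : GF (2 ^ m) a) →
    (t : Quadruple L s) → Legitimate L s t →
    (l : GF.Carrier L) → l ≢ GF.0# L → ¬ [L*]^[σ-1] L s l →
    (S : Semifield b) →
    Isotopic (Semifield.rawRingWithoutOne S) (B L s l t) →
    (Center S ≐ LeftNucleus S) ×
    (Center S ≐ RightNucleus S) ×
    Σ (Subfield L) λ K₁ →
    HasOrder (Subfield.setoid K₁) (2 ^ gcd m s) ×
    (center S ≅ Subfield.rawRing K₁) ×
    (leftNucleus S ≅ Subfield.rawRing K₁) ×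
    (rightNucleus S ≅ Subfield.rawRing K₁)
theorem8 m s 0<s s<m L t legitimate l l≢0 l∉ S isotopic =
  center≐leftNucleus , center≐rightNucleus ,
  fixedField s , fixedField-order-gcd ,
  center≅fixedField , leftNucleus≅fixedField , rightNucleus≅fixedField
  where
  open Multiplication 0<s s<m L t legitimate using (fixedField; fixedField-order-gcd)
  open Isotope 0<s s<m L t legitimate l l≢0 l∉ S isotopic
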